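{- Let $q$ be a prime power, $\mathbb{A}=\mathbb{F}_q[t]$, and let $g\in\mathbb{A}$ be a non-constant polynomial. Then $(g,g)$ is a Chen pair if and only if one of the following holds: (1) $q=2$, $t^3\nmid g$, $(t+1)^3\nmid g$, and $P^2\nmid g$ for every irreducible polynomial $P\in\mathbb{A}$ with $\deg P\ge 2$; or (2) $q>2$ and $g$ is square-free.
   Context: $\mathbb{F}_q$ is the finite field with $q$ elements and $\mathbb{A}=\mathbb{F}_q[t]$. For a non-constant $f\in\mathbb{A}$, $\mathbb{A}_f=\mathbb{A}/f\mathbb{A}$ is the residue class ring modulo $f$, and $\mathcal{A}_f=\{h\in\mathbb{A}:\deg h<\deg f\}\cup\{0\}$, a complete set of representatives of the residue classes modulo $f$; for $h\in\mathcal{A}_f$, $\bar h$ denotes the residue class of $h$ modulo $f$. Let $f,g\in\mathbb{A}$ be non-constant. A function $\sigma:\mathbb{A}_f\to\mathbb{A}_g$ is a polynomial function if there is $F\in\mathbb{A}[x]$ such that $\sigma(\bar h)=F(h)\bmod g$ for all $h\in\mathcal{A}_f$. A function $\sigma:\mathbb{A}_f\to\mathbb{A}_g$ is called congruence preserving if for all $h_1,h_2\in\mathcal{A}_f$ and every $h\in\mathbb{A}$ dividing $g$, $h_1\equiv h_2\pmod h$ implies $\sigma(\bar h_1)\equiv\sigma(\bar h_2)\pmod h$ (here $h_1,h_2$ are regarded as elements of $\mathbb{A}$, and reduction modulo $h$ of elements of $\mathbb{A}_g$ is well defined since $h\mid g$). $(f,g)$ is a Chen pair if every congruence preserving function from $\mathbb{A}_f$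 to $\mathbb{A}_g$ is a polynomial function. -}

module Defs where

open import Algebra.Bundles using (CommutativeRing; Semiring)
open import Algebra.Structures using (IsCommutativeRing)
import Algebra.Definitions.RawMagma as RawMagmaDefinitions
import Algebra.Definitions.RawSemiring as RawSemiringDefinitions
import Algebra.Properties.AbelianGroup as AbelianGroupProperties
import Algebra.Properties.Ring as RingProperties
open import Data.Fin.Base using (Fin)
open import Data.List.Base using (List; []; _∷_; map)
open import Data.Nat.Base as ℕ using (ℕ; zero; suc)
open import Data.Nat.Primality using (Prime)
open import Data.Product.Base using (_×_; _,_; ∃; ∃₂; ∃-syntax)
open import Data.Sum.Base using (_⊎_)
open import Function.Bundles using (Func; Inverse)
open import Level using (Level; _⊔_) renaming (suc to lsuc)
open import Relation.Binary.Bundles using (Setoid)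
import Relation.Binary.Reasoning.Setoid as SetoidReasoning
open import Relation.Binary.PropositionalEquality using (_≡_)
import Relation.Binary.PropositionalEquality as ≡
open import Relation.Nullary.Negation.Core using (¬_)

private
  variable
    c ℓ : Level

------------------------------------------------------------------------
-- Finite fields

IsPrimePower : ℕ → Set
IsPrimePower q = ∃₂ λ p k → Prime p × 1 ℕ.≤ k × q ≡ p ℕ.^ k

record FiniteField (c ℓ : Level) (q : ℕ) : Set (lsuc (c ⊔ ℓ)) where
  field
    commutativeRing : CommutativeRing c ℓ

  open CommutativeRing commutativeRing public

  field
    1≉0         : ¬ (1# ≈ 0#)
    inverse     : ∀ x → ¬ (x ≈ 0#) → ∃[ y ] x * y ≈ 1#
    enumeration : Inverse setoid (≡.setoid (Fin q))

------------------------------------------------------------------------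
-- Univariate polynomials over a commutative ring

-- A polynomial is a list of coefficients, constant term first.  Trailing
-- zeros are allowed, so equality compares coefficients rather than lists.

module Polynomials (R : CommutativeRing c ℓ) where

  private
    module R = CommutativeRing R
    open R using (Carrier; _≈_; 0#; 1#)
    module RP = RingProperties R.ring

  Poly : Set c
  Poly = List Carrier

  coeff : Poly → ℕ → Carrier
  coeff []      _       = 0#
  coeff (a ∷ _) zero    = a
  coeff (_ ∷ p) (suc n) = coeff p n

  infix 4 _≋_
  record _≋_ (p q : Poly) : Set ℓ where
    constructor mk≋
    field
      coeff-≈ : ∀ n → coeff p n ≈ coeff q n

  open _≋_ public

  infixl 6 _⊕_
  infixl 7 _⊛_
  infixr 7 _·_
  infix  8 ⊝_

  _⊕_ : Poly → Poly → Poly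
  []      ⊕ q       = q
  (a ∷ p) ⊕ []      = a ∷ p
  (a ∷ p) ⊕ (b ∷ q) = (a R.+ b) ∷ (p ⊕ q)

  ⊝_ : Poly → Poly
  ⊝_ = map (λ a → R.- a)

  _·_ : Carrier → Poly → Poly
  a · p = map (a R.*_) p

  -- (a + t p) q = a q + t (p q)
  _⊛_ : Poly → Poly → Poly
  []      ⊛ q = []
  (a ∷ p) ⊛ q = (a · q) ⊕ (0# ∷ (p ⊛ q))

  𝟎 𝟏 t : Poly
  𝟎 = []
  𝟏 = 1# ∷ []
  t = 0# ∷ 1# ∷ []

  evaluate : Poly → Carrier → Carrier
  evaluate []      x = 0#
  evaluate (a ∷ p) x = a R.+ x R.* evaluate p x

  -- The zero polynomial has no degree.
  HasDegree : Poly → ℕ → Set ℓ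
  HasDegree p n = ¬ (coeff p n ≈ 0#) × (∀ m → n ℕ.< m → coeff p m ≈ 0#)

  NonConstant : Poly → Set ℓ
  NonConstant p = ∃[ n ] HasDegree p n × 0 ℕ.< n

  ≋-refl : ∀ {p} → p ≋ p
  ≋-refl = mk≋ λ _ → R.refl

  ≋-sym : ∀ {p q} → p ≋ q → q ≋ p
  ≋-sym e = mk≋ λ n → R.sym (coeff-≈ e n)

  ≋-trans : ∀ {p q r} → p ≋ q → q ≋ r → p ≋ r
  ≋-trans e f = mk≋ λ n → R.trans (coeff-≈ e n) (coeff-≈ f n)

  ≋-setoid : Setoid c ℓ
  ≋-setoid = record
    { Carrier = Poly
    ; _≈_ = _≋_
    ; isEquivalence = record { refl = ≋-refl ; sym = ≋-sym ; trans = ≋-trans }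
    }

  private
    module ≋-Reasoning = SetoidReasoning ≋-setoid

  coeff-⊕ : ∀ p q n → coeff (p ⊕ q) n ≈ coeff p n R.+ coeff q n
  coeff-⊕ []      q       n       = R.sym (R.+-identityˡ _)
  coeff-⊕ (a ∷ p) []      n       = R.sym (R.+-identityʳ _)
  coeff-⊕ (a ∷ p) (b ∷ q) zero    = R.refl
  coeff-⊕ (a ∷ p) (b ∷ q) (suc n) = coeff-⊕ p q n

  coeff-⊝ : ∀ p n → coeff (⊝ p) n ≈ R.- coeff p n
  coeff-⊝ []      n       = R.sym RP.-0#≈0#
  coeff-⊝ (a ∷ p) zero    = R.refl
  coeff-⊝ (a ∷ p) (suc n) = coeff-⊝ p n

  coeff-· : ∀ a p n → coeff (a · p) n ≈ a R.* coeff p n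
  coeff-· a []      n       = R.sym (R.zeroʳ a)
  coeff-· a (b ∷ p) zero    = R.refl
  coeff-· a (b ∷ p) (suc n) = coeff-· a p n

  ∷-cong : ∀ {a b p q} → a ≈ b → p ≋ q → a ∷ p ≋ b ∷ q
  ∷-cong a≈b p≋q = mk≋ λ where
    zero    → a≈b
    (suc n) → coeff-≈ p≋q n

  0∷𝟎 : 0# ∷ 𝟎 ≋ 𝟎
  0∷𝟎 = mk≋ λ where
    zero    → R.refl
    (suc n) → R.refl

  ⊕-cong : ∀ {p p′ q q′} → p ≋ p′ → q ≋ q′ → p ⊕ q ≋ p′ ⊕ q′
  ⊕-cong {p} {p′} {q} {q′} e f = mk≋ λ n →
    R.trans (coeff-⊕ p q n)
      (R.trans (R.+-cong (coeff-≈ e n) (coeff-≈ f n)) (R.sym (coeff-⊕ p′ q′ n)))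

  ⊕-assoc : ∀ p q r → (p ⊕ q) ⊕ r ≋ p ⊕ (q ⊕ r)
  ⊕-assoc p q r = mk≋ λ n → begin
    coeff ((p ⊕ q) ⊕ r) n                     ≈⟨ coeff-⊕ (p ⊕ q) r n ⟩
    coeff (p ⊕ q) n R.+ coeff r n             ≈⟨ R.+-congʳ (coeff-⊕ p q n) ⟩
    coeff p n R.+ coeff q n R.+ coeff r n     ≈⟨ R.+-assoc _ _ _ ⟩
    coeff p n R.+ (coeff q n R.+ coeff r n)   ≈⟨ R.+-congˡ (coeff-⊕ q r n) ⟨
    coeff p n R.+ coeff (q ⊕ r) n             ≈⟨ coeff-⊕ p (q ⊕ r) n ⟨
    coeff (p ⊕ (q ⊕ r)) n                     ∎
    where open SetoidReasoning R.setoid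

  ⊕-comm : ∀ p q → p ⊕ q ≋ q ⊕ p
  ⊕-comm p q = mk≋ λ n →
    R.trans (coeff-⊕ p q n) (R.trans (R.+-comm _ _) (R.sym (coeff-⊕ q p n)))

  ⊕-identityˡ : ∀ p → 𝟎 ⊕ p ≋ p
  ⊕-identityˡ p = ≋-refl

  ⊕-identityʳ : ∀ p → p ⊕ 𝟎 ≋ p
  ⊕-identityʳ p = ⊕-comm p 𝟎

  ⊝-cong : ∀ {p q} → p ≋ q → ⊝ p ≋ ⊝ q
  ⊝-cong {p} {q} e = mk≋ λ n →
    R.trans (coeff-⊝ p n) (R.trans (R.-‿cong (coeff-≈ e n)) (R.sym (coeff-⊝ q n)))

  ⊝-inverseˡ : ∀ p → ⊝ p ⊕ p ≋ 𝟎
  ⊝-inverseˡ p = mk≋ λ n →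
    R.trans (coeff-⊕ (⊝ p) p n)
      (R.trans (R.+-congʳ (coeff-⊝ p n)) (R.-‿inverseˡ _))

  ⊝-inverseʳ : ∀ p → p ⊕ ⊝ p ≋ 𝟎
  ⊝-inverseʳ p = ≋-trans (⊕-comm p (⊝ p)) (⊝-inverseˡ p)

  interchange : ∀ p q r s → (p ⊕ q) ⊕ (r ⊕ s) ≋ (p ⊕ r) ⊕ (q ⊕ s)
  interchange p q r s = begin
    (p ⊕ q) ⊕ (r ⊕ s)  ≈⟨ ⊕-assoc p q (r ⊕ s) ⟩
    p ⊕ (q ⊕ (r ⊕ s))  ≈⟨ ⊕-cong (≋-refl {p}) (⊕-assoc q r s) ⟨
    p ⊕ ((q ⊕ r) ⊕ s)  ≈⟨ ⊕-cong (≋-refl {p}) (⊕-cong (⊕-comm q r) ≋-refl) ⟩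
    p ⊕ ((r ⊕ q) ⊕ s)  ≈⟨ ⊕-cong (≋-refl {p}) (⊕-assoc r q s) ⟩
    p ⊕ (r ⊕ (q ⊕ s))  ≈⟨ ⊕-assoc p r (q ⊕ s) ⟨
    (p ⊕ r) ⊕ (q ⊕ s)  ∎
    where open ≋-Reasoning

  ·-cong : ∀ {a b p q} → a ≈ b → p ≋ q → a · p ≋ b · q
  ·-cong {a} {b} {p} {q} e f = mk≋ λ n →
    R.trans (coeff-· a p n)
      (R.trans (R.*-cong e (coeff-≈ f n)) (R.sym (coeff-· b q n)))

  ·-distribˡ : ∀ a p q → a · (p ⊕ q) ≋ a · p ⊕ a · q
  ·-distribˡ a p q = mk≋ λ n → begin
    coeff (a · (p ⊕ q)) n                      ≈⟨ coeff-· a (p ⊕ q) n ⟩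
    a R.* coeff (p ⊕ q) n                      ≈⟨ R.*-congˡ (coeff-⊕ p q n) ⟩
    a R.* (coeff p n R.+ coeff q n)            ≈⟨ R.distribˡ _ _ _ ⟩
    a R.* coeff p n R.+ a R.* coeff q n        ≈⟨ R.+-cong (coeff-· a p n) (coeff-· a q n) ⟨
    coeff (a · p) n R.+ coeff (a · q) n        ≈⟨ coeff-⊕ (a · p) (a · q) n ⟨
    coeff (a · p ⊕ a · q) n                    ∎
    where open SetoidReasoning R.setoid

  ·-distribʳ : ∀ a b p → (a R.+ b) · p ≋ a · p ⊕ b · p
  ·-distribʳ a b p = mk≋ λ n → begin
    coeff ((a R.+ b) · p) n                    ≈⟨ coeff-· (a R.+ b) p n ⟩
    (a R.+ b) R.* coeff p n                    ≈⟨ R.distribʳ _ _ _ ⟩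
    a R.* coeff p n R.+ b R.* coeff p n        ≈⟨ R.+-cong (coeff-· a p n) (coeff-· b p n) ⟨
    coeff (a · p) n R.+ coeff (b · p) n        ≈⟨ coeff-⊕ (a · p) (b · p) n ⟨
    coeff (a · p ⊕ b · p) n                    ∎
    where open SetoidReasoning R.setoid

  ·-assoc : ∀ a b p → (a R.* b) · p ≋ a · (b · p)
  ·-assoc a b p = mk≋ λ n → begin
    coeff ((a R.* b) · p) n    ≈⟨ coeff-· (a R.* b) p n ⟩
    a R.* b R.* coeff p n      ≈⟨ R.*-assoc _ _ _ ⟩
    a R.* (b R.* coeff p n)    ≈⟨ R.*-congˡ (coeff-· b p n) ⟨
    a R.* coeff (b · p) n      ≈⟨ coeff-· a (b · p) n ⟨
    coeff (a · (b · p)) n      ∎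
    where open SetoidReasoning R.setoid

  ·-zero : ∀ p → 0# · p ≋ 𝟎
  ·-zero p = mk≋ λ n → R.trans (coeff-· 0# p n) (R.zeroˡ _)

  ·-identity : ∀ p → 1# · p ≋ p
  ·-identity p = mk≋ λ n → R.trans (coeff-· 1# p n) (R.*-identityˡ _)

  ∷-⊕ : ∀ p q → 0# ∷ (p ⊕ q) ≋ (0# ∷ p) ⊕ (0# ∷ q)
  ∷-⊕ p q = ∷-cong (R.sym (R.+-identityˡ 0#)) ≋-refl

  ⊛-congˡ : ∀ p {q r} → q ≋ r → p ⊛ q ≋ p ⊛ r
  ⊛-congˡ []      e = ≋-refl
  ⊛-congˡ (a ∷ p) e = ⊕-cong (·-cong R.refl e) (∷-cong R.refl (⊛-congˡ p e))

  ⊛-zeroʳ : ∀ p → p ⊛ 𝟎 ≋ 𝟎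
  ⊛-zeroʳ []      = ≋-refl
  ⊛-zeroʳ (a ∷ p) = ≋-trans (∷-cong R.refl (⊛-zeroʳ p)) 0∷𝟎

  ⊛-∷ : ∀ p b q → p ⊛ (b ∷ q) ≋ b · p ⊕ (0# ∷ (p ⊛ q))
  ⊛-∷ []      b q = ≋-sym 0∷𝟎
  ⊛-∷ (a ∷ p) b q = ∷-cong (R.+-congʳ (R.*-comm a b)) (begin
    a · q ⊕ p ⊛ (b ∷ q)                 ≈⟨ ⊕-cong (≋-refl {a · q}) (⊛-∷ p b q) ⟩
    a · q ⊕ (b · p ⊕ (0# ∷ (p ⊛ q)))    ≈⟨ ⊕-assoc (a · q) (b · p) _ ⟨
    (a · q ⊕ b · p) ⊕ (0# ∷ (p ⊛ q))    ≈⟨ ⊕-cong (⊕-comm (a · q) (b · p)) ≋-refl ⟩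
    (b · p ⊕ a · q) ⊕ (0# ∷ (p ⊛ q))    ≈⟨ ⊕-assoc (b · p) (a · q) _ ⟩
    b · p ⊕ (a · q ⊕ (0# ∷ (p ⊛ q)))    ∎)
    where open ≋-Reasoning

  ⊛-comm : ∀ p q → p ⊛ q ≋ q ⊛ p
  ⊛-comm []      q = ≋-sym (⊛-zeroʳ q)
  ⊛-comm (a ∷ p) q = ≋-trans
    (⊕-cong (≋-refl {a · q}) (∷-cong R.refl (⊛-comm p q)))
    (≋-sym (⊛-∷ q a p))

  ⊛-cong : ∀ {p p′ q q′} → p ≋ p′ → q ≋ q′ → p ⊛ q ≋ p′ ⊛ q′
  ⊛-cong {p} {p′} {q} {q′} e f = begin
    p ⊛ q    ≈⟨ ⊛-congˡ p f ⟩
    p ⊛ q′   ≈⟨ ⊛-comm p q′ ⟩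
    q′ ⊛ p   ≈⟨ ⊛-congˡ q′ e ⟩
    q′ ⊛ p′  ≈⟨ ⊛-comm q′ p′ ⟩
    p′ ⊛ q′  ∎
    where open ≋-Reasoning

  ⊛-distribˡ : ∀ p q r → p ⊛ (q ⊕ r) ≋ p ⊛ q ⊕ p ⊛ r
  ⊛-distribˡ []      q r = ≋-refl
  ⊛-distribˡ (a ∷ p) q r = begin
    a · (q ⊕ r) ⊕ (0# ∷ (p ⊛ (q ⊕ r)))
      ≈⟨ ⊕-cong (·-distribˡ a q r) (∷-cong R.refl (⊛-distribˡ p q r)) ⟩
    (a · q ⊕ a · r) ⊕ (0# ∷ (p ⊛ q ⊕ p ⊛ r))
      ≈⟨ ⊕-cong (≋-refl {a · q ⊕ a · r}) (∷-⊕ (p ⊛ q) (p ⊛ r)) ⟩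
    (a · q ⊕ a · r) ⊕ ((0# ∷ (p ⊛ q)) ⊕ (0# ∷ (p ⊛ r)))
      ≈⟨ interchange (a · q) (a · r) _ _ ⟩
    (a · q ⊕ (0# ∷ (p ⊛ q))) ⊕ (a · r ⊕ (0# ∷ (p ⊛ r))) ∎
    where open ≋-Reasoning

  ⊛-distribʳ : ∀ p q r → (q ⊕ r) ⊛ p ≋ q ⊛ p ⊕ r ⊛ p
  ⊛-distribʳ p q r = begin
    (q ⊕ r) ⊛ p     ≈⟨ ⊛-comm (q ⊕ r) p ⟩
    p ⊛ (q ⊕ r)     ≈⟨ ⊛-distribˡ p q r ⟩
    p ⊛ q ⊕ p ⊛ r   ≈⟨ ⊕-cong (⊛-comm p q) (⊛-comm p r) ⟩
    q ⊛ p ⊕ r ⊛ p   ∎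
    where open ≋-Reasoning

  0∷-⊛ : ∀ p q → (0# ∷ p) ⊛ q ≋ 0# ∷ (p ⊛ q)
  0∷-⊛ p q = ⊕-cong (·-zero q) (≋-refl {0# ∷ (p ⊛ q)})

  ·-⊛ : ∀ a p q → (a · p) ⊛ q ≋ a · (p ⊛ q)
  ·-⊛ a []      q = ≋-refl
  ·-⊛ a (b ∷ p) q = begin
    (a R.* b) · q ⊕ (0# ∷ ((a · p) ⊛ q))
      ≈⟨ ⊕-cong (·-assoc a b q) (∷-cong (R.sym (R.zeroʳ a)) (·-⊛ a p q)) ⟩
    a · (b · q) ⊕ a · (0# ∷ (p ⊛ q))
      ≈⟨ ·-distribˡ a (b · q) (0# ∷ (p ⊛ q)) ⟨
    a · (b · q ⊕ (0# ∷ (p ⊛ q))) ∎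
    where open ≋-Reasoning

  ⊛-assoc : ∀ p q r → (p ⊛ q) ⊛ r ≋ p ⊛ (q ⊛ r)
  ⊛-assoc []      q r = ≋-refl
  ⊛-assoc (a ∷ p) q r = begin
    (a · q ⊕ (0# ∷ (p ⊛ q))) ⊛ r
      ≈⟨ ⊛-distribʳ r (a · q) (0# ∷ (p ⊛ q)) ⟩
    (a · q) ⊛ r ⊕ (0# ∷ (p ⊛ q)) ⊛ r
      ≈⟨ ⊕-cong (·-⊛ a q r) (0∷-⊛ (p ⊛ q) r) ⟩
    a · (q ⊛ r) ⊕ (0# ∷ ((p ⊛ q) ⊛ r))
      ≈⟨ ⊕-cong (≋-refl {a · (q ⊛ r)}) (∷-cong R.refl (⊛-assoc p q r)) ⟩
    a · (q ⊛ r) ⊕ (0# ∷ (p ⊛ (q ⊛ r))) ∎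
    where open ≋-Reasoning

  ⊛-identityˡ : ∀ p → 𝟏 ⊛ p ≋ p
  ⊛-identityˡ p =
    ≋-trans (⊕-cong (·-identity p) 0∷𝟎) (⊕-identityʳ p)

  ⊛-identityʳ : ∀ p → p ⊛ 𝟏 ≋ p
  ⊛-identityʳ p = ≋-trans (⊛-comm p 𝟏) (⊛-identityˡ p)

  isCommutativeRing : IsCommutativeRing _≋_ _⊕_ _⊛_ ⊝_ 𝟎 𝟏
  isCommutativeRing = record
    { isRing = record
      { +-isAbelianGroup = record
        { isGroup = record
          { isMonoid = record
            { isSemigroup = record
              { isMagma = record
                { isEquivalence = Setoid.isEquivalence ≋-setoid
                ; ∙-cong = ⊕-cong
                }
              ; assoc = ⊕-assoc
              }
            ; identity = ⊕-identityˡ , ⊕-identityʳ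
            }
          ; inverse = ⊝-inverseˡ , ⊝-inverseʳ
          ; ⁻¹-cong = ⊝-cong
          }
        ; comm = ⊕-comm
        }
      ; *-cong = ⊛-cong
      ; *-assoc = ⊛-assoc
      ; *-identity = ⊛-identityˡ , ⊛-identityʳ
      ; distrib = ⊛-distribˡ , ⊛-distribʳ
      }
    ; *-comm = ⊛-comm
    }

  polynomialRing : CommutativeRing c ℓ
  polynomialRing = record { isCommutativeRing = isCommutativeRing }

------------------------------------------------------------------------
-- Congruences, residue class rings and square-free elements

module Residues (R : CommutativeRing c ℓ) where

  open CommutativeRing R
  open RawSemiringDefinitions (Semiring.rawSemiring semiring) public
    using (_∣_; _∤_; _^_; Irreducible)

  private
    open RawMagmaDefinitions (Semiring.*-rawMagma semiring) using (_,_)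
    module RP = RingProperties ring
    module +G = AbelianGroupProperties +-abelianGroup

  infix 4 _≡_⟨mod_⟩
  _≡_⟨mod_⟩ : Carrier → Carrier → Carrier → Set (c ⊔ ℓ)
  x ≡ y ⟨mod m ⟩ = m ∣ (x - y)

  SquareFree : Carrier → Set (c ⊔ ℓ)
  SquareFree x = ∀ d → d ^ 2 ∣ x → d ∣ 1#

  private
    open SetoidReasoning setoid

    mod-refl : ∀ m {x} → x ≡ x ⟨mod m ⟩
    mod-refl m {x} = 0# , trans (zeroˡ m) (sym (-‿inverseʳ x))

    mod-sym : ∀ m {x y} → x ≡ y ⟨mod m ⟩ → y ≡ x ⟨mod m ⟩
    mod-sym m {x} {y} (k , e) = - k , (begin
      - k * m    ≈⟨ RP.-‿distribˡ-* k m ⟨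
      - (k * m)  ≈⟨ -‿cong e ⟩
      - (x - y)  ≈⟨ +G.⁻¹-anti-homo‿- x y ⟩
      y - x      ∎)

    mod-trans : ∀ m {x y z} → x ≡ y ⟨mod m ⟩ → y ≡ z ⟨mod m ⟩ → x ≡ z ⟨mod m ⟩
    mod-trans m {x} {y} {z} (k , e) (l , f) = k + l , (begin
      (k + l) * m          ≈⟨ distribʳ m k l ⟩
      k * m + l * m        ≈⟨ +-cong e f ⟩
      (x - y) + (y - z)    ≈⟨ +-assoc x (- y) (y - z) ⟩
      x + (- y + (y - z))  ≈⟨ +-congˡ (+-assoc (- y) y (- z)) ⟨
      x + ((- y + y) - z)  ≈⟨ +-congˡ (+-congʳ (-‿inverseˡ y)) ⟩
      x + (0# - z)         ≈⟨ +-congˡ (+-identityˡ (- z)) ⟩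
      x - z                ∎)

  -- The underlying set of R / m R: residue classes are named by arbitrary
  -- representatives, and two names are equal when they are congruent modulo m.
  residueClasses : Carrier → Setoid c (c ⊔ ℓ)
  residueClasses m = record
    { Carrier = Carrier
    ; _≈_     = λ x y → x ≡ y ⟨mod m ⟩
    ; isEquivalence = record
      { refl = mod-refl m ; sym = mod-sym m ; trans = mod-trans m }
    }

------------------------------------------------------------------------
-- Chen pairs in 𝔸 = 𝔽_q[t]

module ChenPairs {q : ℕ} (𝔽 : FiniteField c ℓ q) where

  open Polynomials (FiniteField.commutativeRing 𝔽) public
    using (t; HasDegree; NonConstant)
    renaming (polynomialRing to 𝔸-ring)

  open CommutativeRing 𝔸-ring public
    using (_≈_; _+_; _*_; 0#; 1#)
    renaming (Carrier to 𝔸)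

  open Residues 𝔸-ring public

  open Polynomials 𝔸-ring public
    using ()
    renaming (Poly to 𝔸[x]; evaluate to evaluate[x])

  infix 4 _∈𝒜_
  _∈𝒜_ : 𝔸 → 𝔸 → Set ℓ
  h ∈𝒜 f = (∃₂ λ m n → HasDegree h m × HasDegree f n × m ℕ.< n) ⊎ h ≈ 0#

  -- 𝔸/ f ⟶ 𝔸/ g is the type of functions 𝔸_f → 𝔸_g.  For such a σ, Func.to σ h
  -- is some representative in 𝔸 of σ(h̄), determined up to congruence modulo g.
  infix 4 𝔸/_⟶𝔸/_
  𝔸/_⟶𝔸/_ : 𝔸 → 𝔸 → Set (c ⊔ ℓ)
  𝔸/ f ⟶𝔸/ g = Func (residueClasses f) (residueClasses g)

  module _ {f g : 𝔸} (σ : 𝔸/ f ⟶𝔸/ g) where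

    open Func σ using (to)

    IsPolynomialFunction : Set (c ⊔ ℓ)
    IsPolynomialFunction =
      ∃ λ (F : 𝔸[x]) → ∀ h → h ∈𝒜 f → to h ≡ evaluate[x] F h ⟨mod g ⟩

    IsCongruencePreserving : Set (c ⊔ ℓ)
    IsCongruencePreserving =
      ∀ h₁ h₂ → h₁ ∈𝒜 f → h₂ ∈𝒜 f → ∀ h → h ∣ g →
      h₁ ≡ h₂ ⟨mod h ⟩ → to h₁ ≡ to h₂ ⟨mod h ⟩

  IsChenPair : 𝔸 → 𝔸 → Set (c ⊔ ℓ)
  IsChenPair f g =
    (σ : 𝔸/ f ⟶𝔸/ g) → IsCongruencePreserving σ → IsPolynomialFunction σ

{-# OPTIONS --safe #-}

-- Write A for the polynomial ring.  (g, g) is a Chen pair iff every σ : A → A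
-- that preserves congruences modulo all divisors of g agrees modulo g with a
-- polynomial.
--
-- If g is square-free, such a σ is found by Newton interpolation over a
-- complete list of residues: the step at a node a is solvable because a common
-- divisor d of g and ∏ (a - b) factors into pairwise coprime divisors of the
-- a - b, each of which divides the error at a.  If u ∈ {t, t + 1} over 𝔽₂, the
-- same interpolation works modulo u² at the nodes 0, 1, u, 1 + u.  Coprime
-- moduli combine by the Chinese remainder theorem.
--
-- Conversely let P be irreducible, g = P^e r with e ≥ 2 and P ∤ r, and put
-- m = g / P.  The function m · [P^e ∣ x] preserves congruences.  A polynomial
-- F(x) = a + b x + O(x²) representing it would satisfy
-- 1 + b z ≡ [P ∣ z] (mod P) for all z.  If A / P has a third residue w, the
-- values z = 1 and z = w are incompatible; if e ≥ 3, then F(P) ≡ 0 (mod P²)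
-- forces P ∣ b, which is incompatible with z = 1.

module Submission where

open import Defs
open import Algebra.Bundles using (CommutativeRing; Semiring)
open import Algebra.Bundles.Raw using (RawRing)
import Algebra.Definitions.RawSemiring as RawSemiringDefinitions
import Algebra.Properties.CommutativeSemigroup.Divisibility as CommutativeSemigroupDivisibility
import Algebra.Properties.Ring as RingProperties
import Algebra.Properties.Semiring.Divisibility as SemiringDivisibility
import Algebra.Properties.Semiring.Exp as SemiringExp
import Algebra.Properties.Semiring.Mult as SemiringMult
import Algebra.Solver.Ring as RingSolver
open import Algebra.Solver.Ring.AlmostCommutativeRing
  using (fromCommutativeRing; _-Raw-AlmostCommutative⟶_)
import Algebra.Solver.Ring.NaturalCoefficients.Default as SemiringSolver
open import Data.Empty using (⊥)
open import Data.Fin.Base using (Fin; zero; suc)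
import Data.Fin.Properties as Fin
open import Data.List.Base using (List; []; _∷_; map; allFin; cartesianProductWith)
open import Data.List.Membership.Propositional.Properties using (∈-allFin)
open import Data.List.Relation.Unary.All as All using (All; []; _∷_)
open import Data.List.Relation.Unary.Any as Any using (Any; here; there; any?)
import Data.List.Relation.Unary.Any.Properties as Any
open import Data.Maybe.Base as Maybe using (Maybe)
open import Data.Nat.Base as ℕ using (ℕ; zero; suc; z≤n; s≤s)
import Data.Nat.Properties as ℕ
open import Data.Product.Base using (_×_; _,_; ∃₂; ∃-syntax; proj₁; proj₂)
open import Data.Sum.Base using (_⊎_; inj₁; inj₂; [_,_]′)
open import Data.Unit.Polymorphic.Base using (⊤; tt)
open import Function.Bundles using (_⇔_; mk⇔; Func; Inverse)
open import Level using (Level; _⊔_)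
open import Relation.Binary.Definitions using (tri<; tri≈; tri>)
open import Relation.Binary.PropositionalEquality as ≡ using (_≡_)
import Relation.Binary.Reasoning.Setoid as SetoidReasoning
open import Relation.Nullary using (¬_; Dec; yes; no; contradiction)
open import Relation.Nullary.Decidable using (_×-dec_; ¬?; dec⇒maybe; map′)

private
  variable
    c ℓ : Level

-- A ring solver with integer coefficients

module IntegerSolver (R : CommutativeRing c ℓ) where

  open CommutativeRing R
  private
    open RingProperties ring
    open SemiringMult semiring using (×-homo-+; ×1-homo-*) renaming (_×_ to _×ᵣ_)
    open SetoidReasoning setoid
    module S = SemiringSolver commutativeSemiring

    -- The pair (m , n) stands for the integer m - n.
    pairs : RawRing _ _
    pairs = record
      { Carrier = ℕ × ℕ
      ; _≈_ = _≡_
      ; _+_ = λ (a , b) (c , d) → a ℕ.+ c , b ℕ.+ d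
      ; _*_ = λ (a , b) (c , d) → a ℕ.* c ℕ.+ b ℕ.* d , a ℕ.* d ℕ.+ b ℕ.* c
      ; -_  = λ (a , b) → b , a
      ; 0#  = 0 , 0
      ; 1#  = 1 , 0
      }

    difference : ℕ × ℕ → Carrier
    difference (a , b) = a ×ᵣ 1# - b ×ᵣ 1#

    -- The first two clauses make the constants 0 and 1 evaluate to 0# and 1#
    -- definitionally.
    value : ℕ × ℕ → Carrier
    value (0 , 0) = 0#
    value (1 , 0) = 1#
    value p       = difference p

    value≈ : ∀ p → value p ≈ difference p
    value≈ (0 , 0)            = sym (-‿inverseʳ 0#)
    value≈ (1 , 0)            = sym (trans (+-cong (+-identityʳ 1#) -0#≈0#) (+-identityʳ 1#))
    value≈ (0 , suc n)        = refl
    value≈ (1 , suc n)        = refl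
    value≈ (suc (suc m) , n)  = refl

    difference-+ : ∀ p q → difference (RawRing._+_ pairs p q) ≈ difference p + difference q
    difference-+ (a , b) (c , d) = begin
      (a ℕ.+ c) ×ᵣ 1# - (b ℕ.+ d) ×ᵣ 1#
        ≈⟨ +-cong (×-homo-+ 1# a c) (-‿cong (×-homo-+ 1# b d)) ⟩
      a ×ᵣ 1# + c ×ᵣ 1# - (b ×ᵣ 1# + d ×ᵣ 1#)
        ≈⟨ +-congˡ (-‿+-comm _ _) ⟨
      a ×ᵣ 1# + c ×ᵣ 1# + (- (b ×ᵣ 1#) - d ×ᵣ 1#)
        ≈⟨ S.solve 4 (λ a b c d → a S.:+ c S.:+ (b S.:+ d) S.:= a S.:+ b S.:+ (c S.:+ d)) refl _ _ _ _ ⟩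
      difference (a , b) + difference (c , d) ∎

    difference-* : ∀ p q → difference (RawRing._*_ pairs p q) ≈ difference p * difference q
    difference-* (a , b) (c , d) = begin
      (a ℕ.* c ℕ.+ b ℕ.* d) ×ᵣ 1# - (a ℕ.* d ℕ.+ b ℕ.* c) ×ᵣ 1#
        ≈⟨ +-cong (×-*-+ a c b d) (-‿cong (×-*-+ a d b c)) ⟩
      A * C + B * D - (A * D + B * C)
        ≈⟨ +-congˡ (-‿+-comm _ _) ⟨
      A * C + B * D + (- (A * D) - B * C)
        ≈⟨ +-cong (+-congˡ (sym -B*-D)) (+-cong (-‿distribʳ-* A D) (-‿distribˡ-* B C)) ⟩
      A * C + (- B) * (- D) + (A * - D + - B * C)
        ≈⟨ S.solve 4 (λ a b c d → a S.:* c S.:+ b S.:* d S.:+ (a S.:* d S.:+ b S.:* c)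
            S.:= (a S.:+ b) S.:* (c S.:+ d)) refl _ _ _ _ ⟩
      (A - B) * (C - D) ∎
      where
      A = a ×ᵣ 1#
      B = b ×ᵣ 1#
      C = c ×ᵣ 1#
      D = d ×ᵣ 1#
      ×-*-+ : ∀ a c b d → (a ℕ.* c ℕ.+ b ℕ.* d) ×ᵣ 1# ≈ a ×ᵣ 1# * c ×ᵣ 1# + b ×ᵣ 1# * d ×ᵣ 1#
      ×-*-+ a c b d = trans (×-homo-+ 1# (a ℕ.* c) (b ℕ.* d)) (+-cong (×1-homo-* a c) (×1-homo-* b d))
      -B*-D : - B * - D ≈ B * D
      -B*-D = trans (sym (-‿distribˡ-* B (- D))) (trans (-‿cong (sym (-‿distribʳ-* B D))) (-‿involutive (B * D)))

    homomorphism : pairs -Raw-AlmostCommutative⟶ fromCommutativeRing R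
    homomorphism = record
      { ⟦_⟧    = value
      ; +-homo = λ p q → trans (value≈ (RawRing._+_ pairs p q))
                   (trans (difference-+ p q) (sym (+-cong (value≈ p) (value≈ q))))
      ; *-homo = λ p q → trans (value≈ (RawRing._*_ pairs p q))
                   (trans (difference-* p q) (sym (*-cong (value≈ p) (value≈ q))))
      ; -‿homo = λ (a , b) → trans (value≈ (b , a))
                   (trans (sym (⁻¹-anti-homo‿- _ _)) (-‿cong (sym (value≈ (a , b)))))
      ; 0-homo = refl
      ; 1-homo = refl
      }

    -- Pairs represent integers non-uniquely, so equality is tested by cross addition. A failed test
    -- gives no verdict, since the characteristic may still identify the values.
    value-≈? : ∀ p q → Maybe (value p ≈ value q)
    value-≈? p@(a , b) q@(c , d) = Maybe.map equal (dec⇒maybe (a ℕ.+ d ℕ.≟ c ℕ.+ b))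
      where
      lift : a ℕ.+ d ≡ c ℕ.+ b → a ×ᵣ 1# + d ×ᵣ 1# ≈ c ×ᵣ 1# + b ×ᵣ 1#
      lift e = trans (sym (×-homo-+ 1# a d))
        (trans (reflexive (≡.cong (_×ᵣ 1#) e)) (×-homo-+ 1# c b))
      equal : a ℕ.+ d ≡ c ℕ.+ b → value p ≈ value q
      equal e = trans (value≈ p) (trans (x∙y⁻¹≈ε⇒x≈y _ _ (begin
        a ×ᵣ 1# - b ×ᵣ 1# - (c ×ᵣ 1# - d ×ᵣ 1#)     ≈⟨ +-congˡ (⁻¹-anti-homo‿- _ _) ⟩
        a ×ᵣ 1# - b ×ᵣ 1# + (d ×ᵣ 1# - c ×ᵣ 1#)
          ≈⟨ S.solve 4 (λ a b c d → a S.:+ b S.:+ (d S.:+ c)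
              S.:= a S.:+ d S.:+ (c S.:+ b)) refl _ _ _ _ ⟩
        a ×ᵣ 1# + d ×ᵣ 1# + (- (c ×ᵣ 1#) - b ×ᵣ 1#) ≈⟨ +-cong (lift e) (-‿+-comm _ _) ⟩
        c ×ᵣ 1# + b ×ᵣ 1# - (c ×ᵣ 1# + b ×ᵣ 1#)     ≈⟨ -‿inverseʳ _ ⟩
        0#                                          ∎)) (sym (value≈ q)))

  open RingSolver pairs (fromCommutativeRing R) homomorphism value-≈? public
    using (Polynomial; solve; _:=_; _:+_; _:*_; _:-_; :-_; con)

  :0 :1 : ∀ {n} → Polynomial n
  :0 = con (0 , 0)
  :1 = con (1 , 0)

-- Congruence preserving functions on a commutative ring

module CongruencePreservation (R : CommutativeRing c ℓ) where

  open CommutativeRing R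
  open Residues R public
  open SemiringDivisibility semiring public
    using ( _∣ʳ_; _,_; _∣0; 1∣_; 0∣x⇒x≈0; x∣y∧y≉0⇒x≉0; ∣ʳ-refl; ∣ʳ-reflexive; ∣ʳ-trans
          ; ∣ʳ-respˡ-≈; ∣ʳ-respʳ-≈; x∣ʳy⇒x∣ʳzy; x∣ʳyx )
  open CommutativeSemigroupDivisibility *-commutativeSemigroup public
    using (∙-cong-∣; x∣y⇒zx∣zy; x∣xy)
  open Polynomials R
  open IntegerSolver R
  open SetoidReasoning setoid

  -- Reduces a divisibility to a choice of coefficients and a ring identity.
  ∣-linear : ∀ {d x y z} a b → d ∣ x → d ∣ y → a * x + b * y ≈ z → d ∣ z
  ∣-linear {d} a b (p , pd≈x) (q , qd≈y) e = a * p + b * q , (begin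
    (a * p + b * q) * d
      ≈⟨ solve 5 (λ a b p q d → (a :* p :+ b :* q) :* d
          := a :* (p :* d) :+ b :* (q :* d)) refl a b p q d ⟩
    a * (p * d) + b * (q * d)  ≈⟨ +-cong (*-congˡ pd≈x) (*-congˡ qd≈y) ⟩
    a * _ + b * _              ≈⟨ e ⟩
    _                          ∎)

  ∣-multiple : ∀ {d x z} a → d ∣ x → a * x ≈ z → d ∣ z
  ∣-multiple a d∣x e = ∣ʳ-respʳ-≈ e (x∣ʳy⇒x∣ʳzy a d∣x)

  x∣x^1+n : ∀ x n → x ∣ x ^ suc n
  x∣x^1+n x n = x∣xy x (x ^ n)

  ^2-mono-∣ : ∀ {x y} → x ∣ y → x ^ 2 ∣ y ^ 2
  ^2-mono-∣ x∣y = ∙-cong-∣ x∣y (∙-cong-∣ x∣y ∣ʳ-refl)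

  ∣-swap : ∀ {d x y} → d ∣ x - y → d ∣ y - x
  ∣-swap {x = x} {y} d∣x-y = ∣-multiple (- 1#) d∣x-y
    (solve 2 (λ x y → (:- :1) :* (x :- y) := y :- x) refl x y)

  ∣-replace : ∀ {d x x′ y y′} → d ∣ x - x′ → d ∣ y - y′ → d ∣ x′ - y′ → d ∣ x - y
  ∣-replace {x = x} {x′} {y} {y′} d∣x-x′ d∣y-y′ d∣x′-y′ =
    ∣-linear 1# 1# d∣x-x′ (∣-linear 1# (- 1#) d∣x′-y′ d∣y-y′ refl)
      (solve 4 (λ x x′ y y′ → :1 :* (x :- x′) :+ :1 :* (:1 :* (x′ :- y′) :+ (:- :1) :* (y :- y′))
          := x :- y)
        refl x x′ y y′)

  -- Comaximal elements

  Comaximal : Carrier → Carrier → Set (c ⊔ ℓ)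
  Comaximal x y = ∃₂ λ u v → u * x + v * y ≈ 1#

  -- Multiply the two Bezout identities: every term of the product except the one in `x * y` is a
  -- multiple of `z`.
  comaximal-*ˡ : ∀ {x y z} → Comaximal x z → Comaximal y z → Comaximal (x * y) z
  comaximal-*ˡ {x} {y} {z} (u , v , e) (u′ , v′ , e′) =
    u * u′ , u * x * v′ + v * (u′ * y + v′ * z) , (begin
      u * u′ * (x * y) + (u * x * v′ + v * (u′ * y + v′ * z)) * z
        ≈⟨ solve 7 (λ u u′ v v′ x y z →
             u :* u′ :* (x :* y) :+ (u :* x :* v′ :+ v :* (u′ :* y :+ v′ :* z)) :* z
             := (u :* x :+ v :* z) :* (u′ :* y :+ v′ :* z)) refl u u′ v v′ x y z ⟩
      (u * x + v * z) * (u′ * y + v′ * z)  ≈⟨ *-cong e e′ ⟩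
      1# * 1#                              ≈⟨ *-identityˡ 1# ⟩
      1#                                   ∎)

  comaximal-^ˡ : ∀ {x z} n → Comaximal x z → Comaximal (x ^ n) z
  comaximal-^ˡ zero    _   = 1# , 0# , trans (+-cong (*-identityˡ 1#) (zeroˡ _)) (+-identityʳ 1#)
  comaximal-^ˡ (suc n) x,z = comaximal-*ˡ x,z (comaximal-^ˡ n x,z)

  comaximal-∣ : ∀ {x y z} → Comaximal x y → x ∣ y * z → x ∣ z
  comaximal-∣ {x} {y} {z} (u , v , e) x∣yz = ∣-linear (u * z) v ∣ʳ-refl x∣yz (begin
    u * z * x + v * (y * z)
      ≈⟨ solve 5 (λ u v x y z → u :* z :* x :+ v :* (y :* z) := (u :* x :+ v :* y) :* z) refl u v x y z ⟩
    (u * x + v * y) * z      ≈⟨ *-congʳ e ⟩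
    1# * z                   ≈⟨ *-identityˡ z ⟩
    z                        ∎)

  comaximal-*-∣ : ∀ {x y z} → Comaximal x y → x ∣ z → y ∣ z → x * y ∣ z
  comaximal-*-∣ {x} {y} {z} (u , v , e) x∣z y∣z =
    ∣-linear u v (x∣y⇒zx∣zy x y∣z) (∣ʳ-respʳ-≈ (*-comm z y) (∙-cong-∣ x∣z ∣ʳ-refl)) (begin
      u * (x * z) + v * (y * z)
        ≈⟨ solve 5 (λ u v x y z → u :* (x :* z) :+ v :* (y :* z)
            := (u :* x :+ v :* y) :* z) refl u v x y z ⟩
      (u * x + v * y) * z        ≈⟨ *-congʳ e ⟩
      1# * z                     ≈⟨ *-identityˡ z ⟩
      z                          ∎)

  -- Evaluation of polynomials

  evaluate-⊕ : ∀ F G x → evaluate (F ⊕ G) x ≈ evaluate F x + evaluate G x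
  evaluate-⊕ []      G       x = sym (+-identityˡ _)
  evaluate-⊕ (a ∷ F) []      x = sym (+-identityʳ _)
  evaluate-⊕ (a ∷ F) (b ∷ G) x = trans (+-congˡ (*-congˡ (evaluate-⊕ F G x)))
    (solve 5 (λ a b x f g → a :+ b :+ x :* (f :+ g) := a :+ x :* f :+ (b :+ x :* g)) refl
      a b x (evaluate F x) (evaluate G x))

  evaluate-· : ∀ a F x → evaluate (a · F) x ≈ a * evaluate F x
  evaluate-· a []      x = sym (zeroʳ a)
  evaluate-· a (b ∷ F) x = trans (+-congˡ (*-congˡ (evaluate-· a F x)))
    (solve 4 (λ a b x f → a :* b :+ x :* (a :* f) := a :* (b :+ x :* f)) refl a b x (evaluate F x))

  evaluate-cong-mod : ∀ {m} F {x y} → m ∣ x - y → m ∣ evaluate F x - evaluate F y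
  evaluate-cong-mod []      {x} {y} m∣x-y = ∣ʳ-respʳ-≈ (sym (-‿inverseʳ 0#)) (_ ∣0)
  evaluate-cong-mod (a ∷ F) {x} {y} m∣x-y = ∣-linear (evaluate F x) y m∣x-y (evaluate-cong-mod F m∣x-y)
    (solve 5 (λ a x y f g → f :* (x :- y) :+ y :* (f :- g) := a :+ x :* f :- (a :+ y :* g)) refl
      a x y (evaluate F x) (evaluate F y))

  -- Isolates the constant and linear terms, on which the argument against repeated factors rests;
  -- short lists are padded with zeros.
  evaluate-expand : ∀ F → ∃₂ λ a b → ∃[ G ] ∀ x → evaluate F x ≈ a + x * (b + x * evaluate G x)
  evaluate-expand []          = 0# , 0# , [] , λ x →
    solve 1 (λ x → :0 := :0 :+ x :* (:0 :+ x :* :0)) refl x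
  evaluate-expand (a ∷ [])    = a , 0# , [] , λ x →
    solve 2 (λ a x → a :+ x :* :0 := a :+ x :* (:0 :+ x :* :0)) refl a x
  evaluate-expand (a ∷ b ∷ G) = a , b , G , λ x → refl

  -- The product of the factors `x - b` over the list, built by the rule `x * V - b * V`.
  vanishing : List Carrier → Poly
  vanishing []      = 1# ∷ []
  vanishing (b ∷ L) = (0# ∷ vanishing L) ⊕ (- b) · vanishing L

  evaluate-vanishing-[] : ∀ x → evaluate (vanishing []) x ≈ 1#
  evaluate-vanishing-[] x = trans (+-congˡ (zeroʳ x)) (+-identityʳ 1#)

  evaluate-vanishing-∷ : ∀ b L x → evaluate (vanishing (b ∷ L)) x ≈ (x - b) * evaluate (vanishing L) x
  evaluate-vanishing-∷ b L x = begin
    evaluate (vanishing (b ∷ L)) x  ≈⟨ evaluate-⊕ (0# ∷ vanishing L) ((- b) · vanishing L) x ⟩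
    0# + x * V + evaluate ((- b) · vanishing L) x  ≈⟨ +-congˡ (evaluate-· (- b) (vanishing L) x) ⟩
    0# + x * V + - b * V
      ≈⟨ solve 3 (λ x b v → :0 :+ x :* v :+ (:- b) :* v := (x :- b) :* v) refl x b V ⟩
    (x - b) * V                     ∎
    where V = evaluate (vanishing L) x

  vanishing-vanishes : ∀ L → All (λ b → evaluate (vanishing L) b ≈ 0#) L
  vanishing-vanishes []      = []
  vanishing-vanishes (b ∷ L) =
    trans (evaluate-vanishing-∷ b L b) (trans (*-congʳ (-‿inverseʳ b)) (zeroˡ _)) ∷
    All.map (λ {b′} e → trans (evaluate-vanishing-∷ b L b′) (trans (*-congˡ e) (zeroʳ _))) (vanishing-vanishes L)

  -- Chen moduli and the Chinese remainder theorem

  CongruencePreserving : Carrier → (Carrier → Carrier) → Set (c ⊔ ℓ)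
  CongruencePreserving g σ = ∀ h → h ∣ g → ∀ x y → h ∣ x - y → h ∣ σ x - σ y

  PolynomialModulo : Carrier → (Carrier → Carrier) → Set (c ⊔ ℓ)
  PolynomialModulo g σ = ∃[ F ] ∀ x → g ∣ σ x - evaluate F x

  -- Stated for functions on the whole ring: the case `h = g` of congruence preservation makes such
  -- a `σ` well defined on residue classes.
  Chen : Carrier → Set (c ⊔ ℓ)
  Chen g = ∀ σ → CongruencePreserving g σ → PolynomialModulo g σ

  chen-resp-≈ : ∀ {g g′} → g ≈ g′ → Chen g → Chen g′
  chen-resp-≈ g≈g′ chen σ preserving with chen σ (λ h h∣g → preserving h (∣ʳ-respʳ-≈ g≈g′ h∣g))
  ... | F , interpolates = F , λ x → ∣ʳ-respˡ-≈ g≈g′ (interpolates x)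

  -- Since `v * y` is 1 modulo `x` and 0 modulo `y`, and `u * x` the reverse, these weights glue the
  -- two interpolants.
  chen-* : ∀ {x y} → Comaximal x y → Chen x → Chen y → Chen (x * y)
  chen-* {x} {y} (u , v , e) chen-x chen-y σ preserving
    with chen-x σ (λ h h∣x → preserving h (∣ʳ-trans h∣x (x∣xy x y)))
       | chen-y σ (λ h h∣y → preserving h (x∣ʳy⇒x∣ʳzy x h∣y))
  ... | F , F-interpolates | G , G-interpolates = (v * y) · F ⊕ (u * x) · G , λ h →
    ∣-linear v u
      (∣ʳ-respʳ-≈ (*-comm _ y) (∙-cong-∣ (F-interpolates h) ∣ʳ-refl))
      (x∣y⇒zx∣zy x (G-interpolates h))
      (begin
        v * (y * (σ h - evaluate F h)) + u * (x * (σ h - evaluate G h))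
          ≈⟨ solve 7 (λ u v x y s f g →
               v :* (y :* (s :- f)) :+ u :* (x :* (s :- g))
               := (u :* x :+ v :* y) :* s :- (v :* y :* f :+ u :* x :* g)) refl
               u v x y (σ h) (evaluate F h) (evaluate G h) ⟩
        (u * x + v * y) * σ h - (v * y * evaluate F h + u * x * evaluate G h)
          ≈⟨ +-cong (trans (*-congʳ e) (*-identityˡ _))
               (-‿cong (sym (trans (evaluate-⊕ ((v * y) · F) ((u * x) · G) h)
                 (+-cong (evaluate-· (v * y) F h) (evaluate-· (u * x) G h))))) ⟩
        σ h - evaluate ((v * y) · F ⊕ (u * x) · G) h ∎)

-- Euclidean domains with finitely many elements of bounded size

record Euclidean (R : CommutativeRing c ℓ) : Set (c ⊔ ℓ) where
  open CommutativeRing R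
  field
    size       : Carrier → ℕ
    size-cong  : ∀ {x y} → x ≈ y → size x ≡ size y
    size-0#    : size 0# ≡ 0
    size≡0⇒≈0# : ∀ {x} → size x ≡ 0 → x ≈ 0#
    -- Fits degree plus one, with size 0 for zero: degrees add, so one of the two shifts is surplus.
    size-*     : ∀ {x y} → ¬ x ≈ 0# → ¬ y ≈ 0# → suc (size (x * y)) ≡ size x ℕ.+ size y
    divide     : ∀ x y → ¬ y ≈ 0# → ∃₂ λ k r → x ≈ k * y + r × size r ℕ.< size y
    bounded    : ∀ n → ∃[ L ] ∀ x → size x ℕ.≤ n → Any (x ≈_) L

module EuclideanDivisibility {R : CommutativeRing c ℓ} (E : Euclidean R) where

  open CommutativeRing R
  open Euclidean E
  open CongruencePreservation R
  open Polynomials R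
  open RingProperties ring using (x∙y⁻¹≈ε⇒x≈y)
  open IntegerSolver R
  open SetoidReasoning setoid
  open RawSemiringDefinitions (Semiring.rawSemiring semiring) using (mkIrred)

  -- Sizes, cancellation and decidable divisibility

  infix 4 _≈0?
  _≈0? : ∀ x → Dec (x ≈ 0#)
  x ≈0? = map′ size≡0⇒≈0# (λ e → ≡.trans (size-cong e) size-0#) (size x ℕ.≟ 0)

  size>0 : ∀ {x} → ¬ x ≈ 0# → 0 ℕ.< size x
  size>0 x≉0 = ℕ.n≢0⇒n>0 (λ e → x≉0 (size≡0⇒≈0# e))

  *-≉0 : ∀ {x y} → ¬ x ≈ 0# → ¬ y ≈ 0# → ¬ x * y ≈ 0#
  *-≉0 x≉0 y≉0 xy≈0 = ℕ.1+n≰n (≡.subst (2 ℕ.≤_)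
    (≡.trans (≡.sym (size-* x≉0 y≉0)) (≡.cong suc (≡.trans (size-cong xy≈0) size-0#)))
    (ℕ.+-mono-≤ (size>0 x≉0) (size>0 y≉0)))

  *-cancelˡ : ∀ {x y z} → ¬ x ≈ 0# → x * y ≈ x * z → y ≈ z
  *-cancelˡ {x} {y} {z} x≉0 xy≈xz with (y - z) ≈0?
  ... | yes y-z≈0 = x∙y⁻¹≈ε⇒x≈y y z y-z≈0
  ... | no  y-z≉0 = contradiction (begin
    x * (y - z)    ≈⟨ solve 3 (λ x y z → x :* (y :- z) := x :* y :- x :* z) refl x y z ⟩
    x * y - x * z  ≈⟨ +-congʳ xy≈xz ⟩
    x * z - x * z  ≈⟨ -‿inverseʳ _ ⟩
    0#             ∎) (*-≉0 x≉0 y-z≉0)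

  ∣-cancelˡ : ∀ {x y z} → ¬ x ≈ 0# → x * y ∣ x * z → y ∣ z
  ∣-cancelˡ {x} {y} {z} x≉0 (q , e) = q , *-cancelˡ x≉0 (trans
    (solve 3 (λ x q y → x :* (q :* y) := q :* (x :* y)) refl x q y) e)

  ∣⇒size≤ : ∀ {x y} → x ∣ y → ¬ y ≈ 0# → size x ℕ.≤ size y
  ∣⇒size≤ {x} {y} (q , qx≈y) y≉0 = ℕ.s≤s⁻¹ (≡.subst (suc (size x) ℕ.≤_)
    (≡.trans (≡.sym (size-* q≉0 x≉0)) (≡.cong suc (size-cong qx≈y)))
    (ℕ.+-monoˡ-≤ (size x) (size>0 q≉0)))
    where
    q≉0 : ¬ q ≈ 0#
    q≉0 = x∣y∧y≉0⇒x≉0 (x , trans (*-comm x q) qx≈y) y≉0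
    x≉0 : ¬ x ≈ 0#
    x≉0 = x∣y∧y≉0⇒x≉0 (q , qx≈y) y≉0

  ∣-remainder : ∀ {x y k r} → x ≈ k * y + r → y ∣ x - r
  ∣-remainder {x} {y} {k} {r} x≈ky+r = k , (begin
    k * y          ≈⟨ solve 2 (λ z r → z := z :+ r :- r) refl (k * y) r ⟩
    k * y + r - r  ≈⟨ +-congʳ x≈ky+r ⟨
    x - r          ∎)

  infix 4 _∣?_
  -- Zero divides only zero. Any other `x` divides `y` exactly when the remainder is zero, since a
  -- nonzero remainder is too small to be a multiple of `x`.
  _∣?_ : ∀ x y → Dec (x ∣ y)
  x ∣? y with x ≈0?
  ... | yes x≈0 = map′ (λ y≈0 → ∣ʳ-respʳ-≈ (sym y≈0) (x ∣0))
    (λ x∣y → 0∣x⇒x≈0 (∣ʳ-respˡ-≈ x≈0 x∣y)) (y ≈0?)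
  ... | no  x≉0 with divide y x x≉0
  ... | k , r , y≈kx+r , r<x with r ≈0?
  ... | yes r≈0 = yes (k , sym (trans y≈kx+r (trans (+-congˡ r≈0) (+-identityʳ _))))
  ... | no  r≉0 = no λ x∣y → ℕ.<⇒≱ r<x (∣⇒size≤ (∣-linear 1# (- k) x∣y ∣ʳ-refl (begin
    1# * y + - k * x             ≈⟨ +-congʳ (*-congˡ y≈kx+r) ⟩
    1# * (k * x + r) + - k * x
      ≈⟨ solve 3 (λ k x r → :1 :* (k :* x :+ r) :+ (:- k) :* x := r) refl k x r ⟩
    r                            ∎)) r≉0)

  size≤1⇒∣1 : ∀ {x} → ¬ x ≈ 0# → size x ℕ.≤ 1 → x ∣ 1#
  size≤1⇒∣1 {x} x≉0 size≤1 with divide 1# x x≉0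
  ... | k , r , 1≈kx+r , r<x = k , sym (trans 1≈kx+r (trans (+-congˡ r≈0) (+-identityʳ _)))
    where
    r≈0 : r ≈ 0#
    r≈0 = size≡0⇒≈0# (ℕ.n≤0⇒n≡0 (ℕ.s≤s⁻¹ (ℕ.≤-trans r<x size≤1)))

  nonunit⇒size>1 : ∀ {x} → ¬ x ≈ 0# → x ∤ 1# → 1 ℕ.< size x
  nonunit⇒size>1 x≉0 x∤1 = ℕ.≰⇒> (λ size≤1 → x∤1 (size≤1⇒∣1 x≉0 size≤1))

  size-<-* : ∀ {x y z} → x * y ≈ z → ¬ z ≈ 0# → y ∤ 1# → size x ℕ.< size z
  size-<-* {x} {y} {z} xy≈z z≉0 y∤1 = ℕ.s≤s⁻¹ (≡.subst (2 ℕ.+ size x ℕ.≤_)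
    (≡.trans (ℕ.+-comm (size y) (size x))
      (≡.trans (≡.sym (size-* x≉0 y≉0)) (≡.cong suc (size-cong xy≈z))))
    (ℕ.+-monoˡ-≤ (size x) (nonunit⇒size>1 y≉0 y∤1)))
    where
    x≉0 : ¬ x ≈ 0#
    x≉0 = x∣y∧y≉0⇒x≉0 (y , trans (*-comm y x) xy≈z) z≉0
    y≉0 : ¬ y ≈ 0#
    y≉0 = x∣y∧y≉0⇒x≉0 (x , xy≈z) z≉0

  size-1# : ¬ 1# ≈ 0# → size 1# ≡ 1
  size-1# 1≉0 = ≡.sym (ℕ.+-cancelʳ-≡ (size 1#) 1 (size 1#)
    (≡.trans (≡.cong suc (size-cong (sym (*-identityˡ 1#)))) (size-* 1≉0 1≉0)))

  -- The sizes of two factors add up to 3, so one of them has size at most 1 and is a unit.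
  size≡2⇒irreducible : ∀ {P} → size P ≡ 2 → Irreducible P
  size≡2⇒irreducible {P} P≡2 = mkIrred P∤1 split
    where
    P≉0 : ¬ P ≈ 0#
    P≉0 P≈0 with () ← ≡.trans (≡.sym P≡2) (≡.trans (size-cong P≈0) size-0#)
    1≉0 : ¬ 1# ≈ 0#
    1≉0 1≈0 = P≉0 (trans (sym (*-identityˡ P)) (trans (*-congʳ 1≈0) (zeroˡ P)))
    P∤1 : P ∤ 1#
    P∤1 P∣1 = ℕ.1+n≰n (≡.subst₂ ℕ._≤_ P≡2 (size-1# 1≉0) (∣⇒size≤ P∣1 1≉0))
    split : ∀ {x y} → P ≈ x * y → x ∣ 1# ⊎ y ∣ 1#
    split {x} {y} P≈xy with size x ℕ.≤? 1
    ... | yes x≤1 = inj₁ (size≤1⇒∣1 (x∣y∧y≉0⇒x≉0 (∣ʳ-respʳ-≈ (sym P≈xy) (x∣xy x y)) P≉0) x≤1)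
    ... | no  x≰1 = inj₂ (size≤1⇒∣1 y≉0 (ℕ.+-cancelˡ-≤ 2 (size y) 1 (≡.subst (2 ℕ.+ size y ℕ.≤_)
        (≡.trans (≡.sym (size-* x≉0 y≉0)) (≡.cong suc (≡.trans (size-cong (sym P≈xy)) P≡2)))
        (ℕ.+-monoˡ-≤ (size y) (ℕ.≰⇒> x≰1)))))
      where
      x≉0 : ¬ x ≈ 0#
      x≉0 = x∣y∧y≉0⇒x≉0 (∣ʳ-respʳ-≈ (sym P≈xy) (x∣xy x y)) P≉0
      y≉0 : ¬ y ≈ 0#
      y≉0 = x∣y∧y≉0⇒x≉0 (∣ʳ-respʳ-≈ (sym P≈xy) (x∣ʳyx y x)) P≉0

  -- Greatest common divisors and irreducible elements

  record Bezout (x y : Carrier) : Set (c ⊔ ℓ) where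
    field
      gcd   : Carrier
      gcd∣x : gcd ∣ x
      gcd∣y : gcd ∣ y
      u v   : Carrier
      ux+vy : u * x + v * y ≈ gcd

  bezout : ∀ x y → Bezout x y
  bezout x y = descend (suc (size y)) x y ℕ.≤-refl
    where
    -- Euclid's algorithm; `n` bounds the size of the second argument and makes the recursion
    -- structural.
    descend : ∀ n x y → size y ℕ.< n → Bezout x y
    descend (suc n) x y y<n with y ≈0?
    ... | yes y≈0 = record
      { gcd = x ; gcd∣x = ∣ʳ-refl ; gcd∣y = ∣ʳ-respʳ-≈ (sym y≈0) (x ∣0)
      ; u = 1# ; v = 0# ; ux+vy = solve 2 (λ x y → :1 :* x :+ :0 :* y := x) refl x y }
    ... | no  y≉0 with divide x y y≉0
    ... | k , r , x≈ky+r , r<y with descend n y r (ℕ.<-≤-trans r<y (ℕ.s≤s⁻¹ y<n))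
    ... | record { gcd = d ; gcd∣x = d∣y ; gcd∣y = d∣r ; u = u ; v = v ; ux+vy = uy+vr } = record
      { gcd = d
      ; gcd∣x = ∣-linear k 1# d∣y d∣r (trans (+-congˡ (*-identityˡ r)) (sym x≈ky+r))
      ; gcd∣y = d∣y
      ; u = v
      ; v = u - v * k
      ; ux+vy = begin
          v * x + (u - v * k) * y              ≈⟨ +-congʳ (*-congˡ x≈ky+r) ⟩
          v * (k * y + r) + (u - v * k) * y
            ≈⟨ solve 5 (λ u v k y r → v :* (k :* y :+ r) :+ (u :- v :* k) :* y
                := u :* y :+ v :* r) refl u v k y r ⟩
          u * y + v * r                        ≈⟨ uy+vr ⟩
          d                                    ∎
      }

  gcd∣1⇒comaximal : ∀ {x y} (b : Bezout x y) → Bezout.gcd b ∣ 1# → Comaximal x y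
  gcd∣1⇒comaximal {x} {y} b (q , e) = q * u , q * v , (begin
    q * u * x + q * v * y
      ≈⟨ solve 5 (λ q u v x y → q :* u :* x :+ q :* v :* y := q :* (u :* x :+ v :* y)) refl q u v x y ⟩
    q * (u * x + v * y)    ≈⟨ *-congˡ ux+vy ⟩
    q * gcd                ≈⟨ e ⟩
    1#                     ∎)
    where open Bezout b

  -- The gcd is a factor of the irreducible `P`: either its cofactor is a unit, so `P` divides the
  -- gcd, or the gcd itself is a unit.
  irreducible-∣⊎comaximal : ∀ {P} → Irreducible P → ∀ x → P ∣ x ⊎ Comaximal P x
  irreducible-∣⊎comaximal {P} irreducible x with bezout P x
  ... | b@record { gcd∣x = (q , e) ; gcd∣y = d∣x } with Irreducible.split-∣1 irreducible (sym e)
  ... | inj₁ (q′ , q′q≈1) = inj₁ (∣ʳ-trans (∣-multiple q′ ∣ʳ-refl (begin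
    q′ * P          ≈⟨ *-congˡ e ⟨
    q′ * (q * gcd)  ≈⟨ *-assoc q′ q gcd ⟨
    q′ * q * gcd    ≈⟨ *-congʳ q′q≈1 ⟩
    1# * gcd        ≈⟨ *-identityˡ gcd ⟩
    gcd             ∎)) d∣x)
    where open Bezout b
  ... | inj₂ d∣1 = inj₂ (gcd∣1⇒comaximal b d∣1)

  irreducible-∣-* : ∀ {P} → Irreducible P → ∀ {x y} → P ∣ x * y → P ∣ x ⊎ P ∣ y
  irreducible-∣-* irreducible {x} P∣xy with irreducible-∣⊎comaximal irreducible x
  ... | inj₁ P∣x = inj₁ P∣x
  ... | inj₂ P,x = inj₂ (comaximal-∣ P,x P∣xy)

  irreducible≉0 : ∀ {P} → Irreducible P → ¬ P ≈ 0#
  irreducible≉0 {P} (mkIrred P∤1 split) P≈0 =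
    [ P∤1 , P∤1 ]′ (split {P} {P} (trans P≈0 (sym (trans (*-congʳ P≈0) (zeroˡ P)))))

  -- Descend to a proper nonunit divisor while one exists. The search runs over the finitely many
  -- candidates of size at most `size d`; if it fails, `d` itself is irreducible.
  irreducibleFactor : ∀ d → ¬ d ≈ 0# → d ∤ 1# → ∃[ P ] Irreducible P × P ∣ d
  irreducibleFactor d d≉0 d∤1 = descend (suc (size d)) d d≉0 d∤1 ℕ.≤-refl
    where
    descend : ∀ n d → ¬ d ≈ 0# → d ∤ 1# → size d ℕ.< n → ∃[ P ] Irreducible P × P ∣ d
    descend (suc n) d d≉0 d∤1 d<n with bounded (size d)
    ... | L , covers with any? (λ e → (e ∣? d) ×-dec (¬? (e ∣? 1#) ×-dec (size e ℕ.<? size d))) L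
    ... | yes found with Any.satisfied found
    ... | e , e∣d , e∤1 , e<d
      with descend n e (x∣y∧y≉0⇒x≉0 e∣d d≉0) e∤1 (ℕ.<-≤-trans e<d (ℕ.s≤s⁻¹ d<n))
    ... | P , irreducible , P∣e = P , irreducible , ∣ʳ-trans P∣e e∣d
    descend (suc n) d d≉0 d∤1 d<n | L , covers | no none =
      d , mkIrred d∤1 split , ∣ʳ-refl
      where
      split : ∀ {x y} → d ≈ x * y → x ∣ 1# ⊎ y ∣ 1#
      split {x} {y} d≈xy with x ∣? 1# | y ∣? 1#
      ... | yes x∣1 | _       = inj₁ x∣1
      ... | no  _   | yes y∣1 = inj₂ y∣1
      ... | no  x∤1 | no  y∤1 = contradiction (Any.map properDivisor (covers x (ℕ.<⇒≤ x<d))) none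
        where
        x∣d : x ∣ d
        x∣d = ∣ʳ-respʳ-≈ (sym d≈xy) (x∣xy x y)
        x<d : size x ℕ.< size d
        x<d = size-<-* (sym d≈xy) d≉0 y∤1
        properDivisor : ∀ {e} → x ≈ e → e ∣ d × e ∤ 1# × size e ℕ.< size d
        properDivisor x≈e =
          ∣ʳ-respˡ-≈ x≈e x∣d ,
          (λ e∣1 → x∤1 (∣ʳ-respˡ-≈ (sym x≈e) e∣1)) ,
          ≡.subst (ℕ._< size d) (size-cong x≈e) x<d

  -- Divide by `P` as long as possible; each quotient is smaller because `P` is not a unit.
  valuation : ∀ P → P ∤ 1# → ∀ g → ¬ g ≈ 0# → ∃₂ λ k r → g ≈ P ^ k * r × P ∤ r
  valuation P P∤1 g g≉0 = descend (suc (size g)) g g≉0 ℕ.≤-refl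
    where
    descend : ∀ n g → ¬ g ≈ 0# → size g ℕ.< n → ∃₂ λ k r → g ≈ P ^ k * r × P ∤ r
    descend (suc n) g g≉0 g<n with P ∣? g
    ... | no  P∤g = 0 , g , sym (*-identityˡ g) , P∤g
    ... | yes (q , qP≈g) with descend n q
        (x∣y∧y≉0⇒x≉0 (P , trans (*-comm P q) qP≈g) g≉0)
        (ℕ.<-≤-trans (size-<-* qP≈g g≉0 P∤1) (ℕ.s≤s⁻¹ g<n))
    ... | k , r , q≈P^kr , P∤r = suc k , r , (begin
      g              ≈⟨ qP≈g ⟨
      q * P          ≈⟨ *-congʳ q≈P^kr ⟩
      P ^ k * r * P  ≈⟨ solve 3 (λ p x r → x :* r :* p := p :* x :* r) refl P (P ^ k) r ⟩
      P * P ^ k * r  ∎) , P∤r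

  -- Square-free elements and Newton interpolation

  squareFree-∣ : ∀ {x y} → x ∣ y → SquareFree y → SquareFree x
  squareFree-∣ x∣y squareFree d d²∣x = squareFree d (∣ʳ-trans d²∣x x∣y)

  -- The square of the gcd of `x` and `y` divides `x * y`, so the gcd is a unit.
  squareFree⇒comaximal : ∀ {x y z} → x * y ≈ z → SquareFree z → Comaximal x y
  squareFree⇒comaximal {x} {y} xy≈z squareFree = gcd∣1⇒comaximal b (squareFree gcd
    (∣ʳ-respʳ-≈ xy≈z (∙-cong-∣ gcd∣x (∣ʳ-respˡ-≈ (sym (*-identityʳ gcd)) gcd∣y))))
    where
    b = bezout x y
    open Bezout b

  CommonDivisorsDivide : Carrier → Carrier → Carrier → Carrier → Set (c ⊔ ℓ)
  CommonDivisorsDivide g s a b = ∀ d → d ∣ g → d ∣ a - b → d ∣ s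

  -- The Newton step at a asks for c with c ∏ (a - b) ≡ s (mod g), where b runs
  -- over the nodes L and s is the interpolation error at a.  It is solvable as
  -- soon as the common divisors of g and ∏ (a - b) divide s, and all that is
  -- known of s is that it is divisible by the common divisors of g and each
  -- a - b.
  Admissible : Carrier → Carrier → List Carrier → Set (c ⊔ ℓ)
  Admissible g a L = ∀ s → All (CommonDivisorsDivide g s a) L →
    ∀ d → d ∣ g → d ∣ evaluate (vanishing L) a → d ∣ s

  Interpolable : Carrier → List Carrier → Set (c ⊔ ℓ)
  Interpolable g []      = ⊤
  Interpolable g (a ∷ L) = Admissible g a L × Interpolable g L

  -- Each step adds a multiple of `vanishing L`, which is zero at the old nodes and so leaves the
  -- earlier errors unchanged.
  interpolate : ∀ {g} L → Interpolable g L → ∀ σ → CongruencePreserving g σ →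
    ∃[ F ] All (λ a → g ∣ σ a - evaluate F a) L
  interpolate         []      _                             σ preserving = [] , []
  interpolate {g} (a ∷ L) (admissible , interpolable) σ preserving
    with interpolate L interpolable σ preserving
  ... | F , F-interpolates = F ⊕ k · V , atNode ∷ All.zipWith atOldNode (F-interpolates , vanishing-vanishes L)
    where
    V = vanishing L
    s = σ a - evaluate F a
    open Bezout (bezout (evaluate V a) g)

    -- Modulo a common divisor of `g` and `a - b`, both `σ` and `F` take the same values at `a` and
    -- `b`, so the error at `a` vanishes with the one at `b`.
    agrees : ∀ {b} → g ∣ σ b - evaluate F b → CommonDivisorsDivide g s a b
    agrees {b} g∣error d d∣g d∣a-b =
      ∣-replace (preserving d d∣g a b d∣a-b) (evaluate-cong-mod F d∣a-b) (∣ʳ-trans d∣g g∣error)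

    gcd∣s : gcd ∣ s
    gcd∣s = admissible s (All.map agrees F-interpolates) gcd gcd∣y gcd∣x

    -- Multiplying the Bezout identity by `w` shows that `k` times the value of `V` at `a` is
    -- congruent to `s` modulo `g`.
    w k : Carrier
    w = _∣ʳ_.quotient gcd∣s
    k = w * u

    evaluate-new : ∀ x → evaluate (F ⊕ k · V) x ≈ evaluate F x + k * evaluate V x
    evaluate-new x = trans (evaluate-⊕ F (k · V) x) (+-congˡ (evaluate-· k V x))

    atNode : g ∣ σ a - evaluate (F ⊕ k · V) a
    atNode = ∣-multiple (w * v) ∣ʳ-refl (begin
      w * v * g
        ≈⟨ solve 5 (λ w u v g x → w :* v :* g
            := w :* (u :* x :+ v :* g) :- w :* u :* x) refl w u v g (evaluate V a) ⟩
      w * (u * evaluate V a + v * g) - k * evaluate V a  ≈⟨ +-congʳ (*-congˡ ux+vy) ⟩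
      w * gcd - k * evaluate V a  ≈⟨ +-congʳ (_∣ʳ_.equality gcd∣s) ⟩
      s - k * evaluate V a
        ≈⟨ solve 3 (λ p x y → p :- x :- y
            := p :- (x :+ y)) refl (σ a) (evaluate F a) (k * evaluate V a) ⟩
      σ a - (evaluate F a + k * evaluate V a)  ≈⟨ +-congˡ (-‿cong (evaluate-new a)) ⟨
      σ a - evaluate (F ⊕ k · V) a ∎)

    atOldNode : ∀ {b} → g ∣ σ b - evaluate F b × evaluate V b ≈ 0# → g ∣ σ b - evaluate (F ⊕ k · V) b
    atOldNode {b} (g∣error , V≈0) = ∣ʳ-respʳ-≈ (+-congˡ (-‿cong (sym (begin
      evaluate (F ⊕ k · V) b           ≈⟨ evaluate-new b ⟩
      evaluate F b + k * evaluate V b  ≈⟨ +-congˡ (trans (*-congˡ V≈0) (zeroʳ k)) ⟩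
      evaluate F b + 0#                ≈⟨ +-identityʳ _ ⟩
      evaluate F b                     ∎)))) g∣error

  -- The nodes meet every residue class, and both `σ` and a polynomial respect congruence modulo
  -- `g`.
  covering⇒chen : ∀ {g} L → Interpolable g L → (∀ x → Any (λ a → g ∣ x - a) L) → Chen g
  covering⇒chen {g} L interpolable covers σ preserving with interpolate L interpolable σ preserving
  ... | F , F-interpolates = F , λ x → extend x (covers x) F-interpolates
    where
    extend : ∀ x {L} → Any (λ a → g ∣ x - a) L → All (λ a → g ∣ σ a - evaluate F a) L →
      g ∣ σ x - evaluate F x
    extend x {a ∷ _} (here g∣x-a) (g∣error ∷ _) =
      ∣-replace (preserving g ∣ʳ-refl x a g∣x-a) (evaluate-cong-mod F g∣x-a) g∣error
    extend x (there g∣) (_ ∷ errors) = extend x g∣ errors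

  -- Induction on the nodes. Split `d` into `d′` and its gcd with `a - b`. The gcd divides `s` by
  -- the hypothesis on `b`; `d′` divides the remaining product, hence `s` by induction. The two are
  -- comaximal because `d` is square-free.
  squareFree⇒admissible : ∀ {g} a L → SquareFree g → ¬ g ≈ 0# → Admissible g a L
  squareFree⇒admissible a []      squareFree g≉0 s agrees d d∣g d∣V =
    ∣ʳ-trans (∣ʳ-respʳ-≈ (evaluate-vanishing-[] a) d∣V) (1∣ s)
  squareFree⇒admissible {g} a (b ∷ L) squareFree g≉0 s (agree ∷ agrees) d d∣g d∣V =
    ∣ʳ-respˡ-≈ d′gcd≈d (comaximal-*-∣
      (squareFree⇒comaximal d′gcd≈d (squareFree-∣ d∣g squareFree))
      (squareFree⇒admissible a L squareFree g≉0 s agrees d′ (∣ʳ-trans d′∣d d∣g) d′∣W)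
      (agree gcd (∣ʳ-trans gcd∣x d∣g) gcd∣y))
    where
    W = evaluate (vanishing L) a
    open Bezout (bezout d (a - b))
    d′ : Carrier
    d′ = _∣ʳ_.quotient gcd∣x
    d′gcd≈d : d′ * gcd ≈ d
    d′gcd≈d = _∣ʳ_.equality gcd∣x
    d′∣d : d′ ∣ d
    d′∣d = ∣ʳ-respʳ-≈ d′gcd≈d (x∣xy d′ gcd)
    -- A Bezout combination replaces the factor `a - b` of the product by the gcd, which can then be
    -- cancelled.
    d∣gcd*W : d ∣ gcd * W
    d∣gcd*W = ∣-linear (u * W) v ∣ʳ-refl (∣ʳ-respʳ-≈ (evaluate-vanishing-∷ b L a) d∣V) (begin
      u * W * d + v * ((a - b) * W)
        ≈⟨ solve 5 (λ u v w d x → u :* w :* d :+ v :* (x :* w)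
            := (u :* d :+ v :* x) :* w) refl u v W d (a - b) ⟩
      (u * d + v * (a - b)) * W  ≈⟨ *-congʳ ux+vy ⟩
      gcd * W                    ∎)
    d′∣W : d′ ∣ W
    d′∣W = ∣-cancelˡ (x∣y∧y≉0⇒x≉0 gcd∣x (x∣y∧y≉0⇒x≉0 d∣g g≉0))
      (∣ʳ-respˡ-≈ (trans (sym d′gcd≈d) (*-comm d′ gcd)) d∣gcd*W)

  squareFree⇒chen : ∀ {g} → ¬ g ≈ 0# → SquareFree g → Chen g
  squareFree⇒chen {g} g≉0 squareFree with bounded (size g)
  -- The list may repeat residues; admissibility holds for every list of nodes.
  ... | L , covers = covering⇒chen L (interpolable L) residue
    where
    interpolable : ∀ L → Interpolable g L
    interpolable []      = tt
    interpolable (a ∷ L) = squareFree⇒admissible a L squareFree g≉0 , interpolable L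
    residue : ∀ x → Any (λ a → g ∣ x - a) L
    residue x with divide x g g≉0
    ... | k , r , x≈kg+r , r<g = Any.map
      (λ r≈a → ∣-remainder (trans x≈kg+r (+-congˡ r≈a))) (covers r (ℕ.<⇒≤ r<g))

  -- Squares of elements with residues 0 and 1

  Binary : Carrier → Set (c ⊔ ℓ)
  Binary u = ∀ x → u ∣ x ⊎ u ∣ x - 1#

  size≡2⇒binary : ∀ {u} → (∀ x → size x ℕ.≤ 1 → x ≈ 0# ⊎ x ≈ 1#) → size u ≡ 2 → Binary u
  size≡2⇒binary {u} small u≡2 x with divide x u (irreducible≉0 (size≡2⇒irreducible u≡2))
  ... | k , r , x≈ku+r , r<u with small r (ℕ.s≤s⁻¹ (≡.subst (size r ℕ.<_) u≡2 r<u))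
  ... | inj₁ r≈0 = inj₁ (k , (begin
    k * u            ≈⟨ +-identityʳ _ ⟨
    k * u + 0#       ≈⟨ +-congˡ r≈0 ⟨
    k * u + r        ≈⟨ x≈ku+r ⟨
    x                ∎))
  ... | inj₂ r≈1 = inj₂ (k , (begin
    k * u            ≈⟨ solve 2 (λ y z → y := y :+ z :- z) refl (k * u) 1# ⟩
    k * u + 1# - 1#  ≈⟨ +-congʳ (+-congˡ r≈1) ⟨
    k * u + r - 1#   ≈⟨ +-congʳ x≈ku+r ⟨
    x - 1#           ∎))

  -- In the order 0, 1, u, 1 + u every node is congruent modulo u to at most
  -- one earlier node.
  binary⇒chen-^2 : ∀ {u} → Binary u → Chen (u ^ 2)
  binary⇒chen-^2 {u} binary = covering⇒chen nodes
    (admissible-1+u , admissible-u , admissible-1 , admissible-0 , tt) residue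
    where
    nodes : List Carrier
    nodes = 1# + u ∷ u ∷ 1# ∷ 0# ∷ []

    u² : u ^ 2 ≈ u * u
    u² = *-congˡ (*-identityʳ u)

    V₀ : ∀ x → evaluate (vanishing (0# ∷ [])) x ≈ (x - 0#) * 1#
    V₀ x = trans (evaluate-vanishing-∷ 0# [] x) (*-congˡ (evaluate-vanishing-[] x))
    V₁ : ∀ x → evaluate (vanishing (1# ∷ 0# ∷ [])) x ≈ (x - 1#) * ((x - 0#) * 1#)
    V₁ x = trans (evaluate-vanishing-∷ 1# (0# ∷ []) x) (*-congˡ (V₀ x))
    V₂ : ∀ x → evaluate (vanishing (u ∷ 1# ∷ 0# ∷ [])) x ≈ (x - u) * ((x - 1#) * ((x - 0#) * 1#))
    V₂ x = trans (evaluate-vanishing-∷ u (1# ∷ 0# ∷ []) x) (*-congˡ (V₁ x))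

    admissible-0 : Admissible (u ^ 2) 0# []
    admissible-0 s [] d d∣u² d∣V = ∣ʳ-trans (∣ʳ-respʳ-≈ (evaluate-vanishing-[] 0#) d∣V) (1∣ s)

    admissible-1 : Admissible (u ^ 2) 1# (0# ∷ [])
    admissible-1 s _ d d∣u² d∣V = ∣ʳ-trans (∣ʳ-respʳ-≈
      (trans (V₀ 1#) (solve 0 ((:1 :- :0) :* :1 := :1) refl)) d∣V) (1∣ s)

    admissible-u : Admissible (u ^ 2) u (1# ∷ 0# ∷ [])
    admissible-u s (_ ∷ agree ∷ []) d d∣u² d∣V = agree d d∣u²
      -- The product at `u` is `u * (u - 1)`, that is `- u` modulo `u²`, and `u` is the difference
      -- from the node 0.
      (∣-linear (- 1#) 1# d∣V (∣ʳ-respʳ-≈ u² d∣u²) (trans (+-congʳ (*-congˡ (V₁ u)))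
        (solve 1 (λ u → (:- :1) :* ((u :- :1) :* ((u :- :0) :* :1)) :+ :1 :* (u :* u)
            := u :- :0) refl u)))

    admissible-1+u : Admissible (u ^ 2) (1# + u) (u ∷ 1# ∷ 0# ∷ [])
    admissible-1+u s (_ ∷ agree ∷ _) d d∣u² d∣V = agree d d∣u²
      -- Here the product is `u * (1 + u)`, that is `u` modulo `u²`, the difference from the node 1.
      (∣-linear 1# (- 1#) d∣V (∣ʳ-respʳ-≈ u² d∣u²) (trans (+-congʳ (*-congˡ (V₂ (1# + u))))
        (solve 1 (λ u → :1 :* ((:1 :+ u :- u) :* ((:1 :+ u :- :1) :* ((:1 :+ u :- :0) :* :1)))
          :+ (:- :1) :* (u :* u) := :1 :+ u :- :1) refl u)))

    lift : ∀ {x a k} q → q * u ≈ k → k * u ≈ x - a → u ^ 2 ∣ x - a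
    lift {x} {a} {k} q qu≈k ku≈x-a = q , (begin
      q * u ^ 2    ≈⟨ solve 2 (λ q u → q :* (u :* (u :* :1)) := q :* u :* u) refl q u ⟩
      q * u * u    ≈⟨ *-congʳ qu≈k ⟩
      k * u        ≈⟨ ku≈x-a ⟩
      x - a        ∎)

    shift : ∀ {x a k} → k * u ≈ x - a → (k - 1#) * u ≈ x - (a + u)
    shift {x} {a} {k} e = begin
      (k - 1#) * u  ≈⟨ solve 2 (λ k u → (k :- :1) :* u := k :* u :- u) refl k u ⟩
      k * u - u     ≈⟨ +-congʳ e ⟩
      x - a - u     ≈⟨ solve 3 (λ x a u → x :- a :- u := x :- (a :+ u)) refl x a u ⟩
      x - (a + u)   ∎

    minus-0 : ∀ {x y} → y ≈ x → y ≈ x - 0#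
    minus-0 {x} y≈x = trans y≈x (solve 1 (λ x → x := x :- :0) refl x)

    -- Two digits in base `u`: reduce `x`, then the quotient `k`; a digit 1 in `k` shifts the node
    -- by `u`.
    residue : ∀ x → Any (λ a → u ^ 2 ∣ x - a) nodes
    residue x with binary x
    residue x | inj₁ (k , ku≈x) with binary k
    ... | inj₁ (q , e) = there (there (there (here (lift q e (minus-0 ku≈x)))))
    ... | inj₂ (q , e) = there (here (lift q e
      (trans (shift {x} {0#} (minus-0 ku≈x)) (+-congˡ (-‿cong (+-identityˡ u))))))
    residue x | inj₂ (k , ku≈x-1) with binary k
    ... | inj₁ (q , e) = there (there (here (lift q e ku≈x-1)))
    ... | inj₂ (q , e) = here (lift q e (shift ku≈x-1))

  -- If `u ^ 2` divides `g`, its cofactor is prime to `u` because `u ^ 3` does not divide `g`, so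
  -- Chinese remaindering applies; otherwise nothing is split off.
  splitOff-^2 : ∀ {u g} → Irreducible u → Binary u → ¬ g ≈ 0# → u ^ 3 ∤ g →
    ∃[ r ] r ∣ g × u ^ 2 ∤ r × (Chen r → Chen g)
  splitOff-^2 {u} {g} irreducible binary g≉0 u³∤g with (u ^ 2) ∣? g
  ... | no  u²∤g          = g , ∣ʳ-refl , u²∤g , λ chen → chen
  ... | yes (r , ru²≈g) = r , r∣g , (λ u²∣r → u∤r (∣ʳ-trans (x∣x^1+n u 1) u²∣r)) ,
    λ chen → chen-resp-≈ (trans (*-comm _ r) ru²≈g) (chen-* coprime (binary⇒chen-^2 binary) chen)
    where
    r∣g : r ∣ g
    r∣g = ∣ʳ-respʳ-≈ ru²≈g (x∣xy r (u ^ 2))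
    u∤r : u ∤ r
    u∤r (q , qu≈r) = u³∤g (q , (begin
      q * u ^ 3    ≈⟨ *-assoc q u (u ^ 2) ⟨
      q * u * u ^ 2 ≈⟨ *-congʳ qu≈r ⟩
      r * u ^ 2    ≈⟨ ru²≈g ⟩
      g            ∎))
    coprime : Comaximal (u ^ 2) r
    coprime with irreducible-∣⊎comaximal irreducible r
    ... | inj₁ u∣r = contradiction u∣r u∤r
    ... | inj₂ u,r = comaximal-^ˡ 2 u,r

-- Moduli that are not Chen

module NonChen {R : CommutativeRing c ℓ} (E : Euclidean R) where

  open CommutativeRing R
  open CongruencePreservation R
  open EuclideanDivisibility E
  open Polynomials R
  open IntegerSolver R
  open SetoidReasoning setoid
  open SemiringExp semiring using (^-homo-*)

  -- m [P^(2+k) ∣ x], where m = g / P, is congruence preserving.  If it were given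
  -- by a polynomial a + b x + O(x²), its values at m z would show that
  -- 1 + z b ≡ 0 (mod P) for every z not divisible by P.
  module Indicator {P g r : Carrier} (k : ℕ) (irreducible : Irreducible P)
    (g≈ : g ≈ P ^ (2 ℕ.+ k) * r) (P∤r : P ∤ r) where

    m Q : Carrier
    m = P ^ suc k * r
    Q = P ^ (2 ℕ.+ k)

    Pm≈g : P * m ≈ g
    Pm≈g = trans (sym (*-assoc P (P ^ suc k) r)) (sym g≈)

    P≉0 : ¬ P ≈ 0#
    P≉0 = irreducible≉0 irreducible

    P^n≉0 : ∀ n → ¬ P ^ suc n ≈ 0#
    P^n≉0 zero    = λ e → P≉0 (trans (sym (*-identityʳ P)) e)
    P^n≉0 (suc n) = *-≉0 P≉0 (P^n≉0 n)

    m≉0 : ¬ m ≈ 0#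
    m≉0 = *-≉0 (P^n≉0 k) (λ r≈0 → P∤r (∣ʳ-respʳ-≈ (sym r≈0) (P ∣0)))

    indicator : Carrier → Carrier
    indicator x with Q ∣? x
    ... | yes _ = m
    ... | no  _ = 0#

    indicator-yes : ∀ {x} → Q ∣ x → indicator x ≈ m
    indicator-yes {x} Q∣x with Q ∣? x
    ... | yes _   = refl
    ... | no  Q∤x = contradiction Q∣x Q∤x

    indicator-no : ∀ {x} → Q ∤ x → indicator x ≈ 0#
    indicator-no {x} Q∤x with Q ∣? x
    ... | yes Q∣x = contradiction Q∣x Q∤x
    ... | no  _   = refl

    m∣indicator : ∀ x → m ∣ indicator x
    m∣indicator x with Q ∣? x
    ... | yes _ = ∣ʳ-refl
    ... | no  _ = m ∣0

    -- Let `q` be the cofactor of `h` in `g`. If `P` divides `q`, cancelling it gives the first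
    -- case; otherwise `Q` is comaximal to `q` and divides `q * h`.
    ∣m⊎Q∣ : ∀ h → h ∣ g → h ∣ m ⊎ Q ∣ h
    ∣m⊎Q∣ h (q , qh≈g) with irreducible-∣⊎comaximal irreducible q
    ... | inj₁ (q′ , q′P≈q) = inj₁ (q′ , *-cancelˡ P≉0 (begin
      P * (q′ * h)  ≈⟨ solve 3 (λ p q h → p :* (q :* h) := q :* p :* h) refl P q′ h ⟩
      q′ * P * h    ≈⟨ *-congʳ q′P≈q ⟩
      q * h         ≈⟨ qh≈g ⟩
      g             ≈⟨ Pm≈g ⟨
      P * m         ∎))
    ... | inj₂ P,q = inj₂ (comaximal-∣ (comaximal-^ˡ (2 ℕ.+ k) P,q)
      (r , (trans (*-comm r Q) (trans (sym g≈) (sym qh≈g)))))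

    indicator-cong : ∀ {x y} → Q ∣ x - y → indicator x ≈ indicator y
    indicator-cong {x} {y} Q∣x-y with Q ∣? y
    ... | yes Q∣y = indicator-yes (∣-linear 1# 1# Q∣x-y Q∣y
      (solve 2 (λ x y → :1 :* (x :- y) :+ :1 :* y := x) refl x y))
    ... | no  Q∤y = indicator-no (λ Q∣x → Q∤y (∣-linear 1# (- 1#) Q∣x Q∣x-y
      (solve 2 (λ x y → :1 :* x :+ (:- :1) :* (x :- y) := y) refl x y)))

    -- For `h ∣ m` both values are 0 modulo `h`; for `Q ∣ h` arguments congruent modulo `h` have
    -- equal values.
    indicator-preserves : CongruencePreserving g indicator
    indicator-preserves h h∣g x y h∣x-y with ∣m⊎Q∣ h h∣g
    ... | inj₁ h∣m = ∣-linear 1# (- 1#) (∣ʳ-trans h∣m (m∣indicator x)) (∣ʳ-trans h∣m (m∣indicator y))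
      (solve 2 (λ x y → :1 :* x :+ (:- :1) :* y := x :- y) refl (indicator x) (indicator y))
    ... | inj₂ Q∣h = ∣ʳ-respʳ-≈
      (trans (sym (-‿inverseʳ _)) (+-congʳ (sym (indicator-cong (∣ʳ-trans Q∣h h∣x-y))))) (h ∣0)

    module _ (chen : Chen g) where

      private
        interpolation = chen indicator indicator-preserves
        F = proj₁ interpolation
        expansion = evaluate-expand F
        a = proj₁ expansion
        b = proj₁ (proj₂ expansion)
        G = proj₁ (proj₂ (proj₂ expansion))

        error : ∀ x → g ∣ indicator x - (a + x * (b + x * evaluate G x))
        error x = ∣ʳ-respʳ-≈ (+-congˡ (-‿cong (proj₂ (proj₂ (proj₂ expansion)) x))) (proj₂ interpolation x)

        g∣m-a : g ∣ m - a
        g∣m-a = ∣ʳ-respʳ-≈ (+-cong (indicator-yes (Q ∣0))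
          (-‿cong (solve 3 (λ a b f → a :+ :0 :* (b :+ :0 :* f)
              := a) refl a b (evaluate G 0#)))) (error 0#)

        -- Compare the values at 0 and `m * z`: the quadratic term vanishes modulo `g`, so `P * m`
        -- divides `m * (1# + z * b)`.
        P∣1+zb : ∀ z → P ∤ z → P ∣ 1# + z * b
        P∣1+zb z P∤z = ∣-cancelˡ m≉0 (∣ʳ-respˡ-≈ (trans (sym Pm≈g) (*-comm P m))
          (∣-linear 1# 1# g∣m-a
            (∣-linear (- 1#) (- (z * z * f)) g∣F[mz] g∣mm refl)
            (solve 5 (λ m z a b f →
               :1 :* (m :- a) :+ :1 :* ((:- :1) :* (:0 :- (a :+ m :* z :* (b :+ m :* z :* f)))
                 :+ (:- (z :* z :* f)) :* (m :* m))
               := m :* (:1 :+ z :* b)) refl m z a b f)))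
          where
          x = m * z
          f = evaluate G x
          g∣mm : g ∣ m * m
          g∣mm = P ^ k * r , trans (*-congˡ (sym Pm≈g))
            (solve 4 (λ p e r m → e :* r :* (p :* m) := p :* e :* r :* m) refl P (P ^ k) r m)
          -- The product `m * z` carries exactly `suc k` factors `P`, one fewer than `Q`.
          Q∤x : Q ∤ x
          Q∤x Q∣x = [ P∤r , P∤z ]′ (irreducible-∣-* irreducible (∣-cancelˡ (P^n≉0 k)
            (∣ʳ-respˡ-≈ (*-comm P (P ^ suc k)) (∣ʳ-respʳ-≈ (*-assoc (P ^ suc k) r z) Q∣x))))
          g∣F[mz] : g ∣ 0# - (a + x * (b + x * f))
          g∣F[mz] = ∣ʳ-respʳ-≈ (+-congʳ (indicator-no Q∤x)) (error x)

        P∣1+b : P ∣ 1# + b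
        P∣1+b = ∣ʳ-respʳ-≈ (+-congˡ (*-identityˡ b)) (P∣1+zb 1# (Irreducible.p∤1 irreducible))

      -- Subtracting `w` times `1 + b` from `1 + w * b` eliminates `b`.
      notThreeResidues : ∀ w → P ∤ w → P ∤ 1# - w → ⊥
      notThreeResidues w P∤w P∤1-w = P∤1-w (∣-linear 1# (- w) (P∣1+zb w P∤w) P∣1+b
        (solve 2 (λ w b → :1 :* (:1 :+ w :* b) :+ (:- w) :* (:1 :+ b) := :1 :- w) refl w b))

      -- If P² divided m, hence also a, then F(P) ≡ b P (mod P²) would give P ∣ b.
      P²∤m : P * P ∤ m
      P²∤m PP∣m = Irreducible.p∤1 irreducible (∣-linear 1# (- 1#) P∣1+b P∣b
        (solve 1 (λ b → :1 :* (:1 :+ b) :+ (:- :1) :* b := :1) refl b))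
        where
        f = evaluate G P
        PP∣g : P * P ∣ g
        PP∣g = ∣ʳ-trans PP∣m (P , Pm≈g)
        PP∣a : P * P ∣ a
        PP∣a = ∣-linear 1# (- 1#) PP∣m (∣ʳ-trans PP∣g g∣m-a)
          (solve 2 (λ m a → :1 :* m :+ (:- :1) :* (m :- a) := a) refl m a)
        PP∣F[P] : P * P ∣ a + P * (b + P * f)
        PP∣F[P] = ∣-linear 1# (- 1#) (∣ʳ-trans PP∣m (m∣indicator P)) (∣ʳ-trans PP∣g (error P))
          (solve 2 (λ i v → :1 :* i :+ (:- :1) :* (i :- v)
              := v) refl (indicator P) (a + P * (b + P * f)))
        P∣b : P ∣ b
        P∣b = ∣-cancelˡ P≉0 (∣-linear 1# (- 1#) PP∣F[P]
          (∣-linear 1# f PP∣a ∣ʳ-refl refl)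
          (solve 4 (λ a p b f → :1 :* (a :+ p :* (b :+ p :* f)) :+ (:- :1) :* (:1 :* a :+ f :* (p :* p))
              := p :* b) refl a P b f))

  module _ {P g : Carrier} (irreducible : Irreducible P) (g≉0 : ¬ g ≈ 0#) (chen : Chen g) where

    private
      -- Moves all further factors `P` of the cofactor into the power, as the indicator is built on
      -- the exact exponent.
      exactPower : ∀ n {q} → q * P ^ n ≈ g → ∃₂ λ k r → g ≈ P ^ (n ℕ.+ k) * r × P ∤ r
      exactPower n {q} qP^n≈g
        with valuation P (Irreducible.p∤1 irreducible) q
               (x∣y∧y≉0⇒x≉0 (P ^ n , trans (*-comm (P ^ n) q) qP^n≈g) g≉0)
      ... | k , r , q≈P^kr , P∤r = k , r , (begin
        g                    ≈⟨ qP^n≈g ⟨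
        q * P ^ n            ≈⟨ *-congʳ q≈P^kr ⟩
        P ^ k * r * P ^ n    ≈⟨ solve 3 (λ x y r → x :* r :* y := y :* x :* r) refl (P ^ k) (P ^ n) r ⟩
        P ^ n * P ^ k * r    ≈⟨ *-congʳ (^-homo-* P n k) ⟨
        P ^ (n ℕ.+ k) * r    ∎) , P∤r

    chen⇒^2∤ : ∀ w → P ∤ w → P ∤ 1# - w → P ^ 2 ∤ g
    chen⇒^2∤ w P∤w P∤1-w (q , qP²≈g) =
      let k , r , g≈ , P∤r = exactPower 2 qP²≈g in
      Indicator.notThreeResidues k irreducible g≈ P∤r chen w P∤w P∤1-w

    chen⇒^3∤ : P ^ 3 ∤ g
    chen⇒^3∤ (q , qP³≈g) =
      let k , r , g≈ , P∤r = exactPower 3 qP³≈g in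
      -- The exponent of `P` in `m` is now `2 + k`, which exhibits the factor `P * P`.
      Indicator.P²∤m (suc k) irreducible g≈ P∤r chen
        (P ^ k * r , solve 3 (λ p e r → e :* r :* (p :* p) := p :* (p :* e) :* r) refl P (P ^ k) r)

-- Polynomials over a finite field

module FiniteFieldPolynomials {q : ℕ} (𝔽 : FiniteField c ℓ q) where

  open FiniteField 𝔽
  open Polynomials commutativeRing
  open Inverse enumeration using (to; from; to-cong; strictlyInverseʳ)
  open IntegerSolver commutativeRing

  to-injective : ∀ {x y} → to x ≡ to y → x ≈ y
  to-injective {x} {y} e = trans (sym (strictlyInverseʳ x))
    (trans (reflexive (≡.cong from e)) (strictlyInverseʳ y))

  infix 4 _≟_
  _≟_ : ∀ x y → Dec (x ≈ y)
  x ≟ y = map′ to-injective to-cong (to x Fin.≟ to y)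

  elements : List Carrier
  elements = map from (allFin q)

  ∈-elements : ∀ x → Any (x ≈_) elements
  ∈-elements x = Any.map⁺ (Any.map (λ { ≡.refl → sym (strictlyInverseʳ x) }) (∈-allFin (to x)))

  *-≉0 : ∀ {x y} → ¬ x ≈ 0# → ¬ y ≈ 0# → ¬ x * y ≈ 0#
  *-≉0 {x} {y} x≉0 y≉0 xy≈0 = y≉0 (begin
    y            ≈⟨ *-identityˡ y ⟨
    1# * y       ≈⟨ *-congʳ xx⁻¹≈1 ⟨
    x * x⁻¹ * y  ≈⟨ solve 3 (λ x x⁻¹ y → x :* x⁻¹ :* y := x⁻¹ :* (x :* y)) refl x x⁻¹ y ⟩
    x⁻¹ * (x * y) ≈⟨ *-congˡ xy≈0 ⟩
    x⁻¹ * 0#     ≈⟨ zeroʳ x⁻¹ ⟩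
    0#           ∎)
    where
    open SetoidReasoning setoid
    x⁻¹ = proj₁ (inverse x x≉0)
    xx⁻¹≈1 = proj₂ (inverse x x≉0)

  cancels-leading : ∀ {x l l⁻¹} → l * l⁻¹ ≈ 1# → x + - (x * l⁻¹) * l ≈ 0#
  cancels-leading {x} {l} {l⁻¹} ll⁻¹≈1 = begin
    x + - (x * l⁻¹) * l
      ≈⟨ solve 3 (λ x l⁻¹ l → x :+ (:- (x :* l⁻¹)) :* l := x :* (:1 :- l :* l⁻¹)) refl x l⁻¹ l ⟩
    x * (1# - l * l⁻¹)   ≈⟨ *-congˡ (trans (+-congˡ (-‿cong ll⁻¹≈1)) (-‿inverseʳ 1#)) ⟩
    x * 0#               ≈⟨ zeroʳ x ⟩
    0#                   ∎
    where open SetoidReasoning setoid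

  -- Degree and size

  Below : Poly → ℕ → Set _
  Below p n = ∀ m → n ℕ.≤ m → coeff p m ≈ 0#

  -- Degree plus one, so that the zero polynomial can have size 0.
  HasSize : Poly → ℕ → Set _
  HasSize p zero    = p ≋ 𝟎
  HasSize p (suc n) = HasDegree p n

  hasSize-unique : ∀ {p q} → p ≋ q → ∀ m n → HasSize p m → HasSize q n → m ≡ n
  hasSize-unique p≋q zero    zero    _         _         = ≡.refl
  hasSize-unique p≋q zero    (suc n) p≋𝟎       (q≉0 , _) =
    contradiction (trans (sym (coeff-≈ p≋q n)) (coeff-≈ p≋𝟎 n)) q≉0
  hasSize-unique p≋q (suc m) zero    (p≉0 , _) q≋𝟎       =
    contradiction (trans (coeff-≈ p≋q m) (coeff-≈ q≋𝟎 m)) p≉0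
  hasSize-unique p≋q (suc m) (suc n) (p≉0 , p-below) (q≉0 , q-below) with ℕ.<-cmp m n
  ... | tri< m<n _ _    = contradiction (trans (sym (coeff-≈ p≋q n)) (p-below n m<n)) q≉0
  ... | tri≈ _ ≡.refl _ = ≡.refl
  ... | tri> _ _ n<m    = contradiction (trans (coeff-≈ p≋q m) (q-below m n<m)) p≉0

  hasSize⇒below : ∀ {p} n → HasSize p n → Below p n
  hasSize⇒below zero    p≋𝟎         m _   = coeff-≈ p≋𝟎 m
  hasSize⇒below (suc n) (_ , below) m n<m = below m n<m

  below∧hasSize⇒≤ : ∀ {p} m n → Below p m → HasSize p n → n ℕ.≤ m
  below∧hasSize⇒≤ m zero    _     _         = z≤n
  below∧hasSize⇒≤ m (suc n) below (p≉0 , _) = ℕ.≰⇒> (λ m≤n → p≉0 (below n m≤n))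

  -- Lists may end in zeros, so the tail is measured first and the head decides only when the tail
  -- is zero.
  size : Poly → ℕ
  size []      = 0
  size (a ∷ p) with size p | a ≟ 0#
  ... | suc n | _     = suc (suc n)
  ... | zero  | no  _ = 1
  ... | zero  | yes _ = 0

  hasSize : ∀ p → HasSize p (size p)
  hasSize []      = ≋-refl
  hasSize (a ∷ p) with size p | a ≟ 0# | hasSize p
  ... | suc n | _       | p≉0 , below = p≉0 , λ { (suc m) (s≤s n<m) → below m n<m }
  ... | zero  | no  a≉0 | p≋𝟎         = a≉0 , λ { (suc m) _ → coeff-≈ p≋𝟎 m }
  ... | zero  | yes a≈0 | p≋𝟎         = ≋-trans (∷-cong a≈0 p≋𝟎) 0∷𝟎

  hasSize⇒size : ∀ {p} n → HasSize p n → size p ≡ n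
  hasSize⇒size {p} n = hasSize-unique ≋-refl (size p) n (hasSize p)

  size-cong : ∀ {p q} → p ≋ q → size p ≡ size q
  size-cong {p} {q} p≋q = hasSize-unique p≋q (size p) (size q) (hasSize p) (hasSize q)

  size≡0⇒≋𝟎 : ∀ {p} → size p ≡ 0 → p ≋ 𝟎
  size≡0⇒≋𝟎 {p} e = ≡.subst (HasSize p) e (hasSize p)

  ≉𝟎⇒hasDegree : ∀ p → ¬ p ≋ 𝟎 → ∃[ n ] size p ≡ suc n × HasDegree p n
  ≉𝟎⇒hasDegree p p≉𝟎 with size p | hasSize p
  ... | zero  | p≋𝟎    = contradiction p≋𝟎 p≉𝟎
  ... | suc n | degree = n , ≡.refl , degree

  -- The leading coefficients have a nonzero product. The recursion strips constant terms of `p`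
  -- until its leading coefficient is at the head.
  hasDegree-⊛ : ∀ p q m n → HasDegree p m → HasDegree q n → HasDegree (p ⊛ q) (m ℕ.+ n)
  hasDegree-⊛ []      q m       n (p≉0 , _)       _                = contradiction refl p≉0
  hasDegree-⊛ (a ∷ p) q zero    n (a≉0 , p-below) (q≉0 , q-below) =
    (λ e → *-≉0 a≉0 q≉0 (trans (sym (coeffs n)) e)) ,
    (λ k n<k → trans (coeffs k) (trans (*-congˡ (q-below k n<k)) (zeroʳ a)))
    where
    p≋𝟎 : p ≋ 𝟎
    p≋𝟎 = mk≋ λ k → p-below (suc k) (s≤s z≤n)
    coeffs : ∀ k → coeff ((a ∷ p) ⊛ q) k ≈ a * coeff q k
    coeffs k = trans (coeff-≈ (≋-trans
      (⊕-cong (≋-refl {a · q}) (≋-trans (∷-cong refl (⊛-cong {q = q} p≋𝟎 ≋-refl)) 0∷𝟎))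
      (⊕-identityʳ (a · q))) k) (coeff-· a q k)
  hasDegree-⊛ (a ∷ p) q (suc m) n (p≉0 , p-below) (q≉0 , q-below)
    with hasDegree-⊛ p q m n (p≉0 , λ k m<k → p-below (suc k) (s≤s m<k)) (q≉0 , q-below)
  ... | pq≉0 , pq-below =
    (λ e → pq≉0 (trans (sym (coeffs (m ℕ.+ n) (s≤s (ℕ.m≤n+m n m)))) e)) ,
    λ { (suc k) (s≤s m+n<k) →
        trans (coeffs k (s≤s (ℕ.≤-trans (ℕ.m≤n+m n m) (ℕ.<⇒≤ m+n<k)))) (pq-below k m+n<k) }
    where
    -- Above the degree of `q` the summand `a · q` contributes nothing.
    coeffs : ∀ k → n ℕ.< suc k → coeff ((a ∷ p) ⊛ q) (suc k) ≈ coeff (p ⊛ q) k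
    coeffs k n<1+k = trans (coeff-⊕ (a · q) (0# ∷ (p ⊛ q)) (suc k))
      (trans (+-congʳ (trans (coeff-· a q (suc k)) (trans (*-congˡ (q-below (suc k) n<1+k)) (zeroʳ a))))
        (+-identityˡ _))

  size-⊛ : ∀ {p q} → ¬ p ≋ 𝟎 → ¬ q ≋ 𝟎 → suc (size (p ⊛ q)) ≡ size p ℕ.+ size q
  size-⊛ {p} {q} p≉𝟎 q≉𝟎 with ≉𝟎⇒hasDegree p p≉𝟎 | ≉𝟎⇒hasDegree q q≉𝟎
  ... | m , p≡ , p-degree | n , q≡ , q-degree = ≡.trans
    (≡.cong suc (hasSize⇒size {p ⊛ q} (suc (m ℕ.+ n)) (hasDegree-⊛ p q m n p-degree q-degree)))
    (≡.trans (≡.cong suc (≡.sym (ℕ.+-suc m n))) (≡.cong₂ ℕ._+_ (≡.sym p≡) (≡.sym q≡)))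

  -- Division with remainder and enumeration

  -- Recursion on the coefficients: `p = k d + r` gives `a + t p = (t k) d + (a + t r)`. The new
  -- remainder may reach degree `n`, and subtracting `s` times `d` clears that coefficient.
  division : ∀ p d n → HasDegree d n → ∃₂ λ k r → p ≋ k ⊛ d ⊕ r × Below r n
  division []      d n _ = 𝟎 , 𝟎 , ≋-refl , λ _ _ → refl
  division (a ∷ p) d n degree@(l≉0 , d-below) with division p d n degree
  ... | k , r , p≋kd+r , r-below = (0# ∷ k) ⊕ (s ∷ []) , (a ∷ r) ⊕ (- s) · d , equal , below
    where
    l = coeff d n
    l⁻¹ = proj₁ (inverse l l≉0)
    ll⁻¹≈1 = proj₂ (inverse l l≉0)
    s = coeff (a ∷ r) n * l⁻¹

    s·d : (s ∷ []) ⊛ d ≋ s · d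
    s·d = ≋-trans (⊕-cong (≋-refl {s · d}) 0∷𝟎) (⊕-identityʳ (s · d))

    cancel : s · d ⊕ (- s) · d ≋ 𝟎
    cancel = ≋-trans (≋-sym (·-distribʳ s (- s) d))
      (≋-trans (·-cong (-‿inverseʳ s) (≋-refl {d})) (·-zero d))

    open SetoidReasoning ≋-setoid
    equal : a ∷ p ≋ ((0# ∷ k) ⊕ (s ∷ [])) ⊛ d ⊕ ((a ∷ r) ⊕ (- s) · d)
    equal = begin
      a ∷ p                     ≈⟨ ∷-cong (sym (+-identityˡ a)) p≋kd+r ⟩
      (0# ∷ k ⊛ d) ⊕ (a ∷ r)    ≈⟨ ⊕-cong (≋-sym (0∷-⊛ k d)) ≋-refl ⟩
      K ⊕ (a ∷ r)               ≈⟨ ⊕-identityʳ (K ⊕ (a ∷ r)) ⟨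
      (K ⊕ (a ∷ r)) ⊕ 𝟎         ≈⟨ ⊕-cong (≋-refl {K ⊕ (a ∷ r)}) (≋-sym cancel) ⟩
      (K ⊕ (a ∷ r)) ⊕ (s · d ⊕ (- s) · d)  ≈⟨ interchange K (a ∷ r) (s · d) ((- s) · d) ⟩
      (K ⊕ s · d) ⊕ ((a ∷ r) ⊕ (- s) · d)  ≈⟨ ⊕-cong (⊕-cong (≋-refl {K}) (≋-sym s·d)) ≋-refl ⟩
      (K ⊕ (s ∷ []) ⊛ d) ⊕ ((a ∷ r) ⊕ (- s) · d)
        ≈⟨ ⊕-cong (≋-sym (⊛-distribʳ d (0# ∷ k) (s ∷ []))) ≋-refl ⟩
      ((0# ∷ k) ⊕ (s ∷ [])) ⊛ d ⊕ ((a ∷ r) ⊕ (- s) · d) ∎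
      where
      K = (0# ∷ k) ⊛ d

    coeffs : ∀ m → coeff ((a ∷ r) ⊕ (- s) · d) m ≈ coeff (a ∷ r) m + - s * coeff d m
    coeffs m = trans (coeff-⊕ (a ∷ r) ((- s) · d) m) (+-congˡ (coeff-· (- s) d m))

    below : Below ((a ∷ r) ⊕ (- s) · d) n
    below m n≤m with n ℕ.≟ m
    ... | yes ≡.refl = trans (coeffs n) (cancels-leading ll⁻¹≈1)
    ... | no  n≢m    = trans (coeffs m) (trans
      (+-cong (ar-below m n<m) (trans (*-congˡ (d-below m n<m)) (zeroʳ (- s)))) (+-identityʳ 0#))
      where
      n<m = ℕ.≤∧≢⇒< n≤m n≢m
      ar-below : ∀ m → n ℕ.< m → coeff (a ∷ r) m ≈ 0#
      ar-below (suc m) (s≤s n≤m) = r-below m n≤m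

  polynomialsBelow : ℕ → List Poly
  polynomialsBelow zero    = [] ∷ []
  polynomialsBelow (suc n) = cartesianProductWith _∷_ elements (polynomialsBelow n)

  below⇒∈ : ∀ n p → Below p n → Any (p ≋_) (polynomialsBelow n)
  below⇒∈ zero    p       below = here (mk≋ λ m → below m z≤n)
  -- A list that is too short is matched after padding with zeros.
  below⇒∈ (suc n) []      below = Any.cartesianProductWith⁺ _∷_ (λ x y → ≋-trans (≋-sym 0∷𝟎) (∷-cong x y))
    (∈-elements 0#) (below⇒∈ n [] (λ _ _ → refl))
  below⇒∈ (suc n) (a ∷ p) below = Any.cartesianProductWith⁺ _∷_ ∷-cong
    (∈-elements a) (below⇒∈ n p (λ m n≤m → below (suc m) (s≤s n≤m)))

  euclidean : Euclidean polynomialRing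
  euclidean = record
    { size       = size
    ; size-cong  = size-cong
    ; size-0#    = ≡.refl
    ; size≡0⇒≈0# = size≡0⇒≋𝟎
    ; size-*     = size-⊛
    ; divide     = divide
    ; bounded    = λ n → polynomialsBelow n , λ p p≤n →
        below⇒∈ n p (λ m n≤m → hasSize⇒below (size p) (hasSize p) m (ℕ.≤-trans p≤n n≤m))
    }
    where
    divide : ∀ p d → ¬ d ≋ 𝟎 → ∃₂ λ k r → p ≋ k ⊛ d ⊕ r × size r ℕ.< size d
    divide p d d≉𝟎 with ≉𝟎⇒hasDegree d d≉𝟎
    ... | n , d≡1+n , degree with division p d n degree
    ... | k , r , p≋ , below = k , r , p≋ ,
      ≡.subst (size r ℕ.<_) (≡.sym d≡1+n) (s≤s (below∧hasSize⇒≤ n (size r) below (hasSize r)))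

-- Sets with two and with at least three elements

avoiding : ∀ {n} (i j : Fin (3 ℕ.+ n)) → ∃[ k ] ¬ k ≡ i × ¬ k ≡ j
avoiding zero          zero          = suc zero , (λ ()) , (λ ())
avoiding zero          (suc zero)    = suc (suc zero) , (λ ()) , (λ ())
avoiding zero          (suc (suc _)) = suc zero , (λ ()) , (λ ())
avoiding (suc zero)    zero          = suc (suc zero) , (λ ()) , (λ ())
avoiding (suc zero)    (suc _)       = zero , (λ ()) , (λ ())
avoiding (suc (suc _)) zero          = suc zero , (λ ()) , (λ ())
avoiding (suc (suc _)) (suc _)       = zero , (λ ()) , (λ ())

oneOfTwo : ∀ {i j : Fin 2} → ¬ i ≡ j → ∀ k → k ≡ i ⊎ k ≡ j
oneOfTwo {zero}     {zero}     i≢j _          = contradiction ≡.refl i≢j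
oneOfTwo {zero}     {suc zero} i≢j zero       = inj₁ ≡.refl
oneOfTwo {zero}     {suc zero} i≢j (suc zero) = inj₂ ≡.refl
oneOfTwo {suc zero} {zero}     i≢j zero       = inj₂ ≡.refl
oneOfTwo {suc zero} {zero}     i≢j (suc zero) = inj₁ ≡.refl
oneOfTwo {suc zero} {suc zero} i≢j _          = contradiction ≡.refl i≢j

-- The criterion over a finite field

module ChenPairCriterion {q : ℕ} (𝔽 : FiniteField c ℓ q) where

  private
    module F where
      open FiniteField 𝔽 public
      open Inverse enumeration public using (to; from; strictlyInverseˡ; to-cong)
      open RingProperties ring public using (x∙y⁻¹≈ε⇒x≈y; -0#≈0#)
  open FiniteFieldPolynomials 𝔽
    using (euclidean; to-injective; hasSize; hasSize⇒size; hasSize⇒below; HasSize; ≉𝟎⇒hasDegree)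
  open Polynomials F.commutativeRing
    using (t; HasDegree; NonConstant; coeff; coeff-≈; mk≋; polynomialRing)
  open CommutativeRing polynomialRing hiding (zero) renaming (Carrier to 𝔸)
  open Euclidean euclidean using (size; divide; size-cong)
  open CongruencePreservation polynomialRing
  open EuclideanDivisibility euclidean
  open NonChen euclidean
  open ChenPairs 𝔽 using (_∈𝒜_; IsChenPair)
  open Polynomials polynomialRing using (evaluate)

  constant : F.Carrier → 𝔸
  constant a = a ∷ []

  2≤q : 2 ℕ.≤ q
  2≤q = distinct⇒2≤ (F.to F.1#) (F.to F.0#) (λ e → F.1≉0 (to-injective e))
    where
    distinct⇒2≤ : ∀ {n} (i j : Fin n) → ¬ i ≡ j → 2 ℕ.≤ n
    distinct⇒2≤ {1}           zero zero i≢j = contradiction ≡.refl i≢j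
    distinct⇒2≤ {suc (suc _)} _    _    _   = s≤s (s≤s z≤n)

  thirdElement : 2 ℕ.< q → ∃[ a ] ¬ a F.≈ F.0# × ¬ a F.≈ F.1#
  thirdElement (s≤s (s≤s (s≤s _))) with avoiding (F.to F.0#) (F.to F.1#)
  ... | k , k≢0 , k≢1 = F.from k ,
    (λ e → k≢0 (≡.trans (≡.sym (F.strictlyInverseˡ k)) (F.to-cong e))) ,
    (λ e → k≢1 (≡.trans (≡.sym (F.strictlyInverseˡ k)) (F.to-cong e)))

  zeroOrOne : q ≡ 2 → ∀ a → a F.≈ F.0# ⊎ a F.≈ F.1#
  zeroOrOne ≡.refl a with oneOfTwo (λ e → F.1≉0 (F.sym (to-injective e))) (F.to a)
  ... | inj₁ e = inj₁ (to-injective e)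
  ... | inj₂ e = inj₂ (to-injective e)

  size-constant : ∀ {a} → ¬ a F.≈ F.0# → size (constant a) ≡ 1
  size-constant {a} a≉0 = hasSize⇒size {constant a} 1 (a≉0 , λ { (suc m) _ → F.refl })

  size-linear : ∀ a {b} → ¬ b F.≈ F.0# → size (a ∷ b ∷ []) ≡ 2
  size-linear a {b} b≉0 = hasSize⇒size {a ∷ b ∷ []} 2 (b≉0 , λ { (suc (suc m)) _ → F.refl ; (suc zero) (s≤s ()) })

  size>0⇒≉0 : ∀ {x n} → size x ≡ suc n → ¬ x ≈ 0#
  size>0⇒≉0 x≡1+n x≈0 with () ← ≡.trans (≡.sym x≡1+n) (size-cong x≈0)

  smaller⇒∤ : ∀ {x y} → ¬ y ≈ 0# → size y ℕ.< size x → x ∤ y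
  smaller⇒∤ y≉0 y<x x∣y = ℕ.<⇒≱ y<x (∣⇒size≤ x∣y y≉0)

  size≤1⇒≈0⊎≈1 : q ≡ 2 → ∀ x → size x ℕ.≤ 1 → x ≈ 0# ⊎ x ≈ 1#
  size≤1⇒≈0⊎≈1 q≡2 x x≤1 =
    [ (λ e → inj₁ (mk≋ λ { zero → e ; (suc m) → rest m }))
    , (λ e → inj₂ (mk≋ λ { zero → e ; (suc m) → rest m }))
    ]′ (zeroOrOne q≡2 (coeff x 0))
    where
    rest : ∀ m → coeff x (suc m) F.≈ F.0#
    rest m = hasSize⇒below (size x) (hasSize x) (suc m) (ℕ.≤-trans x≤1 (s≤s z≤n))

  size-t : size t ≡ 2
  size-t = size-linear F.0# F.1≉0

  size-t+1 : size (t + 1#) ≡ 2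
  size-t+1 = size-linear (F.0# F.+ F.1#) F.1≉0

  size≡2⇒t⊎t+1 : q ≡ 2 → ∀ P → size P ≡ 2 → P ≈ t ⊎ P ≈ t + 1#
  size≡2⇒t⊎t+1 q≡2 P P≡2 =
    [ (λ e → inj₁ (equal e)) , (λ e → inj₂ (equal (F.trans e (F.sym (F.+-identityˡ F.1#))))) ]′
    (zeroOrOne q≡2 (coeff P 0))
    where
    degree : HasDegree P 1
    degree = ≡.subst (HasSize P) P≡2 (hasSize P)
    leading : coeff P 1 F.≈ F.1#
    leading = [ (λ e → contradiction e (proj₁ degree)) , (λ e → e) ]′ (zeroOrOne q≡2 (coeff P 1))
    equal : ∀ {a} → coeff P 0 F.≈ a → P ≈ a ∷ F.1# ∷ []
    equal e = mk≋ λ where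
      zero          → e
      (suc zero)    → leading
      (suc (suc m)) → proj₂ degree (suc (suc m)) (s≤s (s≤s z≤n))

  module _ {g : 𝔸} (nonConstant : NonConstant g) where

    private
      n = proj₁ nonConstant
      g-degree : HasDegree g n
      g-degree = proj₁ (proj₂ nonConstant)

    g≉0 : ¬ g ≈ 0#
    g≉0 g≈0 = proj₁ g-degree (coeff-≈ g≈0 n)

    representative : ∀ x → ∃[ r ] r ∈𝒜 g × g ∣ x - r
    representative x = let k , r , x≈kg+r , r<g = divide x g g≉0 in
      r , small r (≡.subst (size r ℕ.<_) (hasSize⇒size {g} (suc n) g-degree) r<g) ,
      ∣-remainder {x} {g} {k} {r} x≈kg+r
      where
      small : ∀ r → size r ℕ.< suc n → r ∈𝒜 g
      small r r<g with size r | hasSize r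
      ... | zero  | r≈0      = inj₂ r≈0
      ... | suc m | r-degree = inj₁ (m , n , r-degree , g-degree , ℕ.s≤s⁻¹ r<g)

    -- Interpolation on `𝒜` extends to every `x` through its representative, because `σ` and `F`
    -- respect congruence modulo `g`.
    isChenPair⇒chen : IsChenPair g g → Chen g
    isChenPair⇒chen isChenPair σ preserving =
      let F , interpolates = isChenPair
            (record { to = σ ; cong = preserving g ∣ʳ-refl _ _ })
            (λ x y _ _ h h∣g → preserving h h∣g x y) in
      F , λ x → let r , r∈𝒜 , g∣x-r = representative x in
        ∣-replace {g} {σ x} {σ r} {evaluate F x} {evaluate F r}
          (preserving g ∣ʳ-refl x r g∣x-r) (evaluate-cong-mod F {x} {r} g∣x-r) (interpolates r r∈𝒜)

    chen⇒isChenPair : Chen g → IsChenPair g g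
    chen⇒isChenPair chen σ preserving =
      let F , interpolates = chen σ.to preserving′ in F , λ x _ → interpolates x
      where
      module σ = Func σ
      -- The hypothesis speaks of arguments in `𝒜`. Passing to representatives changes arguments and
      -- values by multiples of `g`, hence of `h`.
      preserving′ : CongruencePreserving g σ.to
      preserving′ h h∣g x y h∣x-y =
        let r , r∈𝒜 , g∣x-r = representative x
            s , s∈𝒜 , g∣y-s = representative y in
        ∣-replace {h} {σ.to x} {σ.to r} {σ.to y} {σ.to s}
          (∣ʳ-trans h∣g (σ.cong {x} {r} g∣x-r))
          (∣ʳ-trans h∣g (σ.cong {y} {s} g∣y-s))
          (preserving r s r∈𝒜 s∈𝒜 h h∣g (∣-replace {h} {r} {x} {s} {y}
            (∣-swap {h} {x} {r} (∣ʳ-trans h∣g g∣x-r)) (∣-swap {h} {y} {s} (∣ʳ-trans h∣g g∣y-s)) h∣x-y))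

    nonunit⇒irreducible^2∣ : ∀ {d} → d ^ 2 ∣ g → d ∤ 1# → ∃[ P ] Irreducible P × P ∣ d × P ^ 2 ∣ g
    nonunit⇒irreducible^2∣ {d} d²∣g d∤1 =
      let P , irreducible , P∣d = irreducibleFactor d
            (x∣y∧y≉0⇒x≉0 (∣ʳ-trans (x∣x^1+n d 1) d²∣g) g≉0) d∤1 in
      P , irreducible , P∣d , ∣ʳ-trans (^2-mono-∣ P∣d) d²∣g

    -- A third field element serves as the third residue: a nonunit `P` divides no nonzero constant.
    chen⇒squareFree : 2 ℕ.< q → Chen g → SquareFree g
    chen⇒squareFree 2<q chen d d²∣g with d ∣? 1#
    ... | yes d∣1 = d∣1
    ... | no  d∤1 =
      let P , irreducible , _ , P²∣g = nonunit⇒irreducible^2∣ d²∣g d∤1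
          a , a≉0 , a≉1 = thirdElement 2<q
          1-a≉0 : ¬ F.1# F.- a F.≈ F.0#
          1-a≉0 = λ e → a≉1 (F.sym (F.x∙y⁻¹≈ε⇒x≈y F.1# a e))
          P∤constant : ∀ {b} → ¬ b F.≈ F.0# → P ∤ constant b
          P∤constant = λ {b} b≉0 → smaller⇒∤ (size>0⇒≉0 {constant b} (size-constant b≉0))
            (≡.subst (ℕ._< size P) (≡.sym (size-constant b≉0))
              (nonunit⇒size>1 (irreducible≉0 irreducible) (Irreducible.p∤1 irreducible)))
      in contradiction P²∣g (chen⇒^2∤ irreducible g≉0 chen (constant a) (P∤constant a≉0) (P∤constant 1-a≉0))

    -- The third residue is `t`: both `t` and `1# - t` have smaller degree than `P`.
    chen⇒degree≥2^2∤ : Chen g → ∀ P → Irreducible P → ∀ n → HasDegree P n → 2 ℕ.≤ n → P ^ 2 ∤ g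
    chen⇒degree≥2^2∤ chen P irreducible n degree 2≤n = chen⇒^2∤ irreducible g≉0 chen t
      (smaller⇒∤ {P} {t} (size>0⇒≉0 {t} size-t) (smaller t size-t))
      (smaller⇒∤ {P} {1# - t} (size>0⇒≉0 {1# - t} size-1-t) (smaller (1# - t) size-1-t))
      where
      size-1-t : size (1# - t) ≡ 2
      size-1-t = size-linear (F.1# F.- F.0#) (λ e → F.1≉0 (F.x∙y⁻¹≈ε⇒x≈y F.1# F.0#
        (F.trans (F.+-congˡ F.-0#≈0#) (F.trans (F.+-identityʳ _) (-1≈0⇒ e)))))
        where
        -1≈0⇒ : F.- F.1# F.≈ F.0# → F.1# F.≈ F.0#
        -1≈0⇒ e = F.trans (F.sym (F.+-identityʳ F.1#)) (F.trans (F.+-congˡ (F.sym e)) (F.-‿inverseʳ F.1#))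
      smaller : ∀ x → size x ≡ 2 → size x ℕ.< size P
      smaller x x≡2 = ≡.subst₂ ℕ._<_ (≡.sym x≡2) (≡.sym (hasSize⇒size {P} (suc n) degree)) (s≤s 2≤n)

    -- Split off the squares of `t` and `t + 1#`. A repeated irreducible factor of what remains
    -- would have degree 1, and over two elements that means `t` or `t + 1#`.
    binary-conditions⇒chen : q ≡ 2 → t ^ 3 ∤ g → (t + 1#) ^ 3 ∤ g →
      (∀ P → Irreducible P → ∀ n → HasDegree P n → 2 ℕ.≤ n → P ^ 2 ∤ g) → Chen g
    binary-conditions⇒chen q≡2 t³∤g [t+1]³∤g P²∤g =
      let r , r∣g , t²∤r , extend-r = splitOff {t} size-t g≉0 t³∤g
          r≉0 = x∣y∧y≉0⇒x≉0 r∣g g≉0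
          s , s∣r , [t+1]²∤s , extend-s = splitOff {t + 1#} size-t+1 r≉0
            (λ ∣r → [t+1]³∤g (∣ʳ-trans ∣r r∣g))
      in extend-r (extend-s (squareFree⇒chen (x∣y∧y≉0⇒x≉0 s∣r r≉0)
           (squareFree (∣ʳ-trans s∣r r∣g) (λ ∣s → t²∤r (∣ʳ-trans ∣s s∣r)) [t+1]²∤s)))
      where
      splitOff : ∀ {u} → size u ≡ 2 → ∀ {f} → ¬ f ≈ 0# → u ^ 3 ∤ f →
        ∃[ r ] r ∣ f × u ^ 2 ∤ r × (Chen r → Chen f)
      splitOff {u} u≡2 = splitOff-^2 {u} (size≡2⇒irreducible {u} u≡2)
        (size≡2⇒binary {u} (size≤1⇒≈0⊎≈1 q≡2) u≡2)

      squareFree : ∀ {s} → s ∣ g → t ^ 2 ∤ s → (t + 1#) ^ 2 ∤ s → SquareFree s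
      squareFree {s} s∣g t²∤s [t+1]²∤s d d²∣s with d ∣? 1#
      ... | yes d∣1 = d∣1
      ... | no  d∤1 =
        let P , irreducible , P∣d , P²∣g = nonunit⇒irreducible^2∣ (∣ʳ-trans d²∣s s∣g) d∤1 in
        contradiction (∣ʳ-trans (^2-mono-∣ P∣d) d²∣s) (P²∤s P irreducible)
        where
        P²∤s : ∀ P → Irreducible P → P ^ 2 ∤ s
        P²∤s P irreducible P²∣s =
          let n , P≡ , degree = ≉𝟎⇒hasDegree P (irreducible≉0 irreducible) in byDegree n P≡ degree
          where
          byDegree : ∀ n → size P ≡ suc n → HasDegree P n → ⊥
          byDegree zero          P≡1 _ = ℕ.<-irrefl (≡.sym P≡1)
            (nonunit⇒size>1 (irreducible≉0 irreducible) (Irreducible.p∤1 irreducible))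
          byDegree (suc zero)    P≡2 _ =
            [ (λ P≈t → t²∤s (∣ʳ-trans (^2-mono-∣ (∣ʳ-reflexive (sym P≈t))) P²∣s))
            , (λ P≈t+1 → [t+1]²∤s (∣ʳ-trans (^2-mono-∣ (∣ʳ-reflexive (sym P≈t+1))) P²∣s))
            ]′ (size≡2⇒t⊎t+1 q≡2 P P≡2)
          byDegree (suc (suc n)) _ degree =
            P²∤g P irreducible (suc (suc n)) degree (s≤s (s≤s z≤n)) (∣ʳ-trans P²∣s s∣g)

corollary1p9 : {c ℓ : Level} (q : ℕ) → IsPrimePower q → (𝔽 : FiniteField c ℓ q) →
    let open ChenPairs 𝔽 in
    (g : 𝔸) → NonConstant g →
    IsChenPair g g ⇔
    ( ( q ≡ 2
    × t ^ 3 ∤ g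
    × (t + 1#) ^ 3 ∤ g
    × (∀ P → Irreducible P → ∀ n → HasDegree P n → 2 ℕ.≤ n → P ^ 2 ∤ g) )
    ⊎ ( 2 ℕ.< q × SquareFree g ) )
corollary1p9 q _ 𝔽 g nonConstant = mk⇔
  (λ isChenPair → conditions (isChenPair⇒chen nonConstant isChenPair))
  (λ where
    (inj₁ (q≡2 , t³∤g , [t+1]³∤g , P²∤g)) →
      chen⇒isChenPair nonConstant (binary-conditions⇒chen nonConstant q≡2 t³∤g [t+1]³∤g P²∤g)
    (inj₂ (_ , squareFree)) →
      chen⇒isChenPair nonConstant (squareFree⇒chen (g≉0 nonConstant) squareFree))
  where
  open ChenPairCriterion 𝔽
  open FiniteFieldPolynomials 𝔽 using (euclidean)
  open ChenPairs 𝔽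
  open CongruencePreservation 𝔸-ring using (Chen)
  open EuclideanDivisibility euclidean using (squareFree⇒chen; size≡2⇒irreducible)
  open NonChen euclidean using (chen⇒^3∤)

  conditions : Chen g →
    ( q ≡ 2
    × t ^ 3 ∤ g
    × (t + 1#) ^ 3 ∤ g
    × (∀ P → Irreducible P → ∀ n → HasDegree P n → 2 ℕ.≤ n → P ^ 2 ∤ g) )
    ⊎ ( 2 ℕ.< q × SquareFree g )
  conditions chen with ℕ.<-cmp 2 q
  ... | tri< 2<q _ _ = inj₂ (2<q , chen⇒squareFree nonConstant 2<q chen)
  ... | tri≈ _ 2≡q _ = inj₁
    ( ≡.sym 2≡q
    , chen⇒^3∤ {t} (size≡2⇒irreducible {t} size-t) (g≉0 nonConstant) chen
    , chen⇒^3∤ {t + 1#} (size≡2⇒irreducible {t + 1#} size-t+1) (g≉0 nonConstant) chen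
    , chen⇒degree≥2^2∤ nonConstant chen )
  ... | tri> _ _ q<2 = contradiction 2≤q (ℕ.<⇒≱ q<2)
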